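{- Let $G=(V,E)$ be a finite simple undirected graph and let $P=\{a_1,\dots,a_k\}\subseteq V$ be such that $G[P]$ is a path graph and $\deg(a)=2$ for all $a\in P$. Let $\Gamma(P)=\{a_0,a_{k+1}\}$ and $\Gamma(a_i)=\{a_{i-1},a_{i+1}\}$ for $i=1,\dots,k$. Then there exists a node ordering $\sigma'=x_1\cdots x_i\,a_1\cdots a_k\,x_{i+1}\cdots x_\ell$ of $G$, where $V\setminus P=\{x_1,\dots,x_\ell\}$, such that $\phi(G,\sigma')=\Phi(G)$.
   Context: $\Gamma(v)$ is the neighborhood of $v$; for $A\subseteq V$, $\Gamma(A)=\left(\bigcup_{x\in A}\Gamma(x)\right)\setminus A$. $G[P]$ is the subgraph induced by $P$. The deficiency of $x$ in $G$ is $D_G(x)=\{\{c,d\}: c,d\in\Gamma_G(x),\ c\neq d,\ \{c,d\}\notin E\}$. Eliminating $x$ gives $G_x=(V\setminus\{x\},\,E(V\setminus\{x\})\cup D_G(x))$, where $E(U)$ denotes the edges with both endpoints in $U$. A node ordering of $G$ with $n=|V|$ is a bijection $\sigma:\{1,\dots,n\}\to V$, written $x_1x_2\cdots x_n$ with $\sigma(j)=x_j$; it defines $G^{(0)}=G$, $G^{(i)}=(G^{(i-1)})_{\sigma(i)}$, and has fill-in $\phi(G,\sigma)=\sum_{i=1}^n|D_{G^{(i-1)}}(\sigma(i))|$. $\Phi(G)=\min_\sigma\phi(G,\sigma)$. -}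

module Defs where

open import Data.Nat using (ℕ; zero; suc; _+_; _<_; _≤_)
open import Data.Bool using (Bool; true; false; _∧_; _∨_; not)
open import Data.Fin using (Fin; toℕ)
open import Data.Fin.Properties using (_≟_)
open import Data.Fin.Permutation using (Permutation′; _⟨$⟩ʳ_)
open import Data.List using (List; []; _∷_; map; allFin; length; filterᵇ; concatMap)
open import Data.Product using (_×_; _,_)
open import Relation.Binary.PropositionalEquality using (_≡_)
open import Relation.Nullary.Decidable using (⌊_⌋)
open import Data.Nat using (_<ᵇ_)

record Graph (n : ℕ) : Set where
  field
    adj   : Fin n → Fin n → Bool
    sym   : ∀ u v → adj u v ≡ adj v u
    irrefl : ∀ v → adj v v ≡ false
open Graph public

count : ∀ {A : Set} → (A → Bool) → List A → ℕ
count p xs = length (filterᵇ p xs)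

deg : ∀ {n} → Graph n → Fin n → ℕ
deg {n} G v = count (adj G v) (allFin n)

pairs : ∀ n → List (Fin n × Fin n)
pairs n = concatMap (λ c → map (λ d → (c , d)) (filterᵇ (λ d → toℕ c <ᵇ toℕ d) (allFin n))) (allFin n)

-- Adjacency of the current (partially eliminated) graph.  Eliminated vertices are
-- kept in Fin n but are isolated; since elimination only adds edges between
-- neighbours of the eliminated vertex (which are still present), this faithfully
-- represents the graphs G^(i).
Adj : ℕ → Set
Adj n = Fin n → Fin n → Bool

deficiency : ∀ {n} → Adj n → Fin n → ℕ
deficiency {n} A x = count (λ { (c , d) → A x c ∧ A x d ∧ not (A c d) }) (pairs n)

eliminate : ∀ {n} → Adj n → Fin n → Adj n
eliminate A x c d =
  (A c d ∨ (A x c ∧ A x d ∧ not ⌊ c ≟ d ⌋)) ∧ not ⌊ c ≟ x ⌋ ∧ not ⌊ d ≟ x ⌋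

fillList : ∀ {n} → Adj n → List (Fin n) → ℕ
fillList A [] = 0
fillList A (x ∷ xs) = deficiency A x + fillList (eliminate A x) xs

-- A node ordering is a bijection σ from positions {0,…,n-1} (i.e. 1..n shifted) to V.
-- φ(G , σ) = Σ_i |D_{G^(i-1)}(σ(i))|
fillIn : ∀ {n} → Graph n → Permutation′ n → ℕ
fillIn {n} G σ = fillList (adj G) (map (σ ⟨$⟩ʳ_) (allFin n))

{-# OPTIONS --safe #-}

-- Fill-in is governed by triangulations: the least fill-in is the least number of edges whose
-- addition to G yields a graph H with a perfect elimination order.  Contracting an edge uv of such
-- an H gives another such graph.  Let v be the first path vertex, with neighbours u and w.  If u
-- and v have a common neighbour in H, the contraction saves at least as many edges as eliminating
-- v first costs, so v may be moved to the front, and one continues with the next path vertex.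
-- Otherwise uv is a bridge of H, hence the path separates G.  Then the perfect elimination order
-- of the side of u can be changed so that u comes last, and the order: side of u, path, rest, is
-- perfect for a subgraph of H containing G.
module Submission where

open import Defs hiding (sym)
import Defs
import Algebra.Properties.CommutativeMonoid.Sum
open import Data.Bool using (Bool; true; false; _∧_; _∨_; not; if_then_else_)
import Data.Bool.Properties as Bool
open import Data.Empty using (⊥; ⊥-elim)
open import Data.Fin using (Fin; toℕ; zero; suc)
open import Data.Fin.Permutation using (Permutation′; _⟨$⟩ˡ_; _⟨$⟩ʳ_; inverseʳ; transpose)
open import Data.Fin.Properties using (_≟_; any?; all?; toℕ-injective; injective⇒≤)
open import Data.List using (List; []; _∷_; _++_; allFin; applyUpTo; cartesianProductWith; concatMap; filter; filterᵇ; length; lookup; map; tabulate)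
import Data.List.Extrema
import Data.List.Membership.DecPropositional as DecMembership
open import Data.List.Membership.Propositional using (_∈_; _∉_; find; lose)
open import Data.List.Membership.Propositional.Properties using (∈-allFin; ∈-applyUpTo⁺; ∈-applyUpTo⁻; ∈-cartesianProductWith⁺; ∈-filter⁺; ∈-filter⁻; ∈-lookup; ∈-map⁺; ∈-++⁺ˡ; ∈-++⁺ʳ; ∈-++⁻)
open import Data.List.Properties using (filter-++; length-++; length-map; length-tabulate; map-tabulate; tabulate-lookup)
open import Data.List.Relation.Binary.Permutation.Propositional using (_↭_; ↭-sym; ↭⇒↭ₛ)
open import Data.List.Relation.Binary.Permutation.Propositional.Properties using (∈-resp-↭)
import Data.List.Relation.Binary.Permutation.Setoid.Properties as SetoidPerm
open import Data.List.Relation.Unary.All as All using (All; []; _∷_)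
open import Data.List.Relation.Unary.All.Properties using (all-filter)
open import Data.List.Relation.Unary.AllPairs as AllPairs using (AllPairs; []; _∷_)
open import Data.List.Relation.Unary.Any as Any using (here; there; index)
open import Data.List.Relation.Unary.Any.Properties using (lookup-index; ¬Any[])
open import Data.List.Relation.Unary.Sorted.TotalOrder.Properties using (Sorted⇒AllPairs)
open import Data.List.Relation.Unary.Unique.Propositional using (Unique)
import Data.List.Relation.Unary.Unique.Propositional.Properties as Unique
import Data.List.Sort
open import Data.Nat using (ℕ; zero; suc; _+_; _*_; _∸_; _≤_; _<_; _<ᵇ_; z≤n; s≤s; z<s; s<s; s<s⁻¹)
open import Data.Nat.Properties using (*-identityʳ; *-identityˡ; +-0-commutativeMonoid; +-assoc; +-cancelʳ-≤; +-cancelˡ-≡; +-comm; +-identityʳ; +-mono-≤; +-monoʳ-<; +-monoʳ-≤; 0≢1+n; 1+n≢0; <-asym; <-cmp; <-irrefl; <-trans; <-≤-trans; <ᵇ⇒<; <⇒<ᵇ; <⇒≢; m<n⇒m<1+n; m≤m+n; m≤n+m; m≤n⇒m<n∨m≡n; n<1+n; n≤0⇒n≡0; suc-injective; ≤-antisym; ≤-decTotalOrder; ≤-refl; ≤-reflexive; ≤-totalOrder; ≤-trans; ≤∧≢⇒<; module ≤-Reasoning)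
open import Data.Product using (Σ; ∃; ∃₂; _×_; _,_; proj₁; proj₂)
open import Data.Sum as Sum using (_⊎_; inj₁; inj₂; [_,_])
open import Function using (_∘_; id)
open import Function.Bundles using (_⇔_; _↔_; mk↔ₛ′; module Equivalence; module Injection; module Inverse)
open import Function.Properties.Inverse using (↔⇒↣)
open import Relation.Binary using (tri<; tri≈; tri>)
open import Relation.Binary.Bundles using (module DecTotalOrder)
import Relation.Binary.Construct.On as On
open import Relation.Binary.PropositionalEquality using (_≡_; _≢_; refl; sym; trans; cong; cong₂; setoid; subst; subst₂; ≢-sym; module ≡-Reasoning)
open import Relation.Nullary using (¬_; Dec; yes; no)
open import Relation.Nullary.Decidable using (T?; ⌊_⌋; ¬?; _×-dec_)
open Algebra.Properties.CommutativeMonoid.Sum +-0-commutativeMonoid using (sum; sum-cong-≗; sum-replicate-zero; ∑-comm; ∑-distrib-+)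

-- The order cannot always start with the path: if G is a path on three vertices and P its middle,
-- eliminating P first costs one fill edge, although G needs none. Contracting uv deletes v and
-- hands its edges to u. The only fill edge that this can create without absorbing another one is
-- uw, which comes from the edge vw of G. If u = w or uw lies in H, there is nothing to pay; a
-- common neighbour x other than w pays, because ux and vx merge and vx is a fill edge. Only without
-- common neighbours is uw left unpaid. The recursion may meet such a bridge after several
-- contractions. The contracted triangulation is then discarded: only the cut is pulled back to G
-- and combined with the original H, which may have edges across it. Hence the passage to a subgraph
-- of H, in which the edge from u to the path is the only one leaving the side of u. That side has
-- to end with u, so that no vertex has later neighbours both inside and outside the side.

-- Reflection of Boolean tests

∧-true⁻ : ∀ {a b} → a ∧ b ≡ true → a ≡ true × b ≡ true
∧-true⁻ {true} {true} _ = refl , refl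

∧-true⁺ : ∀ {a b} → a ≡ true → b ≡ true → a ∧ b ≡ true
∧-true⁺ refl refl = refl

∨-true⁻ : ∀ {a b} → a ∨ b ≡ true → a ≡ true ⊎ b ≡ true
∨-true⁻ {true}  _ = inj₁ refl
∨-true⁻ {false} p = inj₂ p

∨-true⁺ : ∀ {a b} → a ≡ true ⊎ b ≡ true → a ∨ b ≡ true
∨-true⁺         (inj₁ refl) = refl
∨-true⁺ {true}  (inj₂ refl) = refl
∨-true⁺ {false} (inj₂ refl) = refl

not-true⁻ : ∀ {a} → not a ≡ true → a ≢ true
not-true⁻ {false} _ ()

not-true⁺ : ∀ {a} → a ≢ true → not a ≡ true
not-true⁺ {true}  p = ⊥-elim (p refl)
not-true⁺ {false} _ = refl

true⇔⇒≡ : ∀ {a b} → (a ≡ true → b ≡ true) → (b ≡ true → a ≡ true) → a ≡ b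
true⇔⇒≡ {true}          f _ = sym (f refl)
true⇔⇒≡ {false} {true}  _ g = g refl
true⇔⇒≡ {false} {false} _ _ = refl

⌊⌋-true⁻ : ∀ {P : Set} {P? : Dec P} → ⌊ P? ⌋ ≡ true → P
⌊⌋-true⁻ {P? = yes p} _ = p

⌊⌋-true⁺ : ∀ {P : Set} {P? : Dec P} → P → ⌊ P? ⌋ ≡ true
⌊⌋-true⁺ {P? = yes _} _ = refl
⌊⌋-true⁺ {P? = no ¬p} p = ⊥-elim (¬p p)

not⌊⌋-true⁻ : ∀ {P : Set} {P? : Dec P} → not ⌊ P? ⌋ ≡ true → ¬ P
not⌊⌋-true⁻ {P? = no ¬p} _ = ¬p

not⌊⌋-true⁺ : ∀ {P : Set} {P? : Dec P} → ¬ P → not ⌊ P? ⌋ ≡ true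
not⌊⌋-true⁺ {P? = yes p} ¬p = ⊥-elim (¬p p)
not⌊⌋-true⁺ {P? = no _}  _  = refl

<ᵇ-true : ∀ {m n} → m < n → (m <ᵇ n) ≡ true
<ᵇ-true m<n = Equivalence.to Bool.T-≡ (<⇒<ᵇ m<n)

<ᵇ-true⁻ : ∀ {m n} → (m <ᵇ n) ≡ true → m < n
<ᵇ-true⁻ {m} {n} p = <ᵇ⇒< m n (Equivalence.from Bool.T-≡ p)

<ᵇ-false : ∀ {m n} → ¬ (m < n) → (m <ᵇ n) ≡ false
<ᵇ-false {m} {n} ¬p with m <ᵇ n in eq
... | true  = ⊥-elim (¬p (<ᵇ-true⁻ eq))
... | false = refl

-- Counting pairs of vertices

𝟙 : Bool → ℕ
𝟙 b = if b then 1 else 0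

𝟙-mono : ∀ {a b} → (a ≡ true → b ≡ true) → 𝟙 a ≤ 𝟙 b
𝟙-mono {true}  f rewrite f refl = ≤-refl
𝟙-mono {false} f = z≤n

𝟙-disjoint : ∀ {a b c} → (a ≡ true → c ≡ true) → (b ≡ true → c ≡ true) →
  (a ≡ true → b ≡ true → ⊥) → 𝟙 a + 𝟙 b ≤ 𝟙 c
𝟙-disjoint {true}  {true}  f g h = ⊥-elim (h refl refl)
𝟙-disjoint {true}  {false} f g h rewrite f refl = ≤-refl
𝟙-disjoint {false} {b}     f g h = 𝟙-mono g

𝟙-cover : ∀ {a b c} → (c ≡ true → a ≡ true ⊎ b ≡ true) → 𝟙 c ≤ 𝟙 a + 𝟙 b
𝟙-cover         {c = false} f = z≤n
𝟙-cover {a} {b} {c = true}  f with f refl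
... | inj₁ refl = s≤s z≤n
... | inj₂ refl = m≤n+m 1 (𝟙 a)

sum-mono : ∀ {n} {f g : Fin n → ℕ} → (∀ i → f i ≤ g i) → sum f ≤ sum g
sum-mono {zero}  f≤g = z≤n
sum-mono {suc n} f≤g = +-mono-≤ (f≤g zero) (sum-mono (f≤g ∘ suc))

sum-δ : ∀ {n} (u : Fin n) (f : Fin n → ℕ) → sum (λ c → 𝟙 ⌊ c ≟ u ⌋ * f c) ≡ f u
sum-δ {suc n} zero f =
  trans (cong₂ _+_ (*-identityˡ (f zero)) (sum-replicate-zero n)) (+-identityʳ (f zero))
sum-δ {suc n} (suc u) f = trans (sum-cong-≗ shift) (sum-δ u (f ∘ suc))
  where
  shift : ∀ c → 𝟙 ⌊ suc c ≟ suc u ⌋ * f (suc c) ≡ 𝟙 ⌊ c ≟ u ⌋ * f (suc c)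
  shift c with c ≟ u
  ... | yes _ = refl
  ... | no _  = refl

edges : ∀ {n} → Adj n → ℕ
edges p = sum λ c → sum λ d → 𝟙 ((toℕ c <ᵇ toℕ d) ∧ p c d)

count-++ : ∀ {A : Set} (p : A → Bool) xs ys → count p (xs ++ ys) ≡ count p xs + count p ys
count-++ p xs ys = trans (cong length (filter-++ (T? ∘ p) xs ys)) (length-++ (filterᵇ p xs))

count-map : ∀ {A B : Set} (p : B → Bool) (g : A → B) xs → count p (map g xs) ≡ count (p ∘ g) xs
count-map p g [] = refl
count-map p g (x ∷ xs) with p (g x)
... | true  = cong suc (count-map p g xs)
... | false = count-map p g xs

count-filter : ∀ {A : Set} (p q : A → Bool) xs →
  count p (filterᵇ q xs) ≡ count (λ x → q x ∧ p x) xs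
count-filter p q [] = refl
count-filter p q (x ∷ xs) with q x
... | false = count-filter p q xs
... | true with p x
...   | true  = cong suc (count-filter p q xs)
...   | false = count-filter p q xs

count-tabulate : ∀ {A : Set} {n} (p : A → Bool) (g : Fin n → A) →
  count p (tabulate g) ≡ sum (𝟙 ∘ p ∘ g)
count-tabulate {n = zero}  p g = refl
count-tabulate {n = suc n} p g with p (g zero)
... | true  = cong suc (count-tabulate p (g ∘ suc))
... | false = count-tabulate p (g ∘ suc)

count-concatMap : ∀ {A B : Set} {n} (p : B → Bool) (f : A → List B) (g : Fin n → A) →
  count p (concatMap f (tabulate g)) ≡ sum (λ i → count p (f (g i)))
count-concatMap {n = zero}  p f g = refl
count-concatMap {n = suc n} p f g =
  trans (count-++ p (f (g zero)) (concatMap f (tabulate (g ∘ suc))))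
        (cong (count p (f (g zero)) +_) (count-concatMap p f (g ∘ suc)))

count-pairs : ∀ {n} (p : Fin n × Fin n → Bool) → count p (pairs n) ≡ edges (λ c d → p (c , d))
count-pairs {n} p = trans (count-concatMap p pairsFrom (λ c → c)) (sum-cong-≗ row)
  where
  pairsFrom : Fin n → List (Fin n × Fin n)
  pairsFrom c = map (c ,_) (filterᵇ (λ d → toℕ c <ᵇ toℕ d) (tabulate (λ d → d)))
  row : ∀ c → count p (pairsFrom c) ≡ sum λ d → 𝟙 ((toℕ c <ᵇ toℕ d) ∧ p (c , d))
  row c = trans (count-map p (c ,_) (filterᵇ (λ d → toℕ c <ᵇ toℕ d) (tabulate (λ d → d))))
    (trans (count-filter (λ d → p (c , d)) (λ d → toℕ c <ᵇ toℕ d) (tabulate (λ d → d)))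
           (count-tabulate (λ d → (toℕ c <ᵇ toℕ d) ∧ p (c , d)) (λ d → d)))

edges-+ : ∀ {n} (p q : Adj n) →
  (sum λ c → sum λ d → 𝟙 ((toℕ c <ᵇ toℕ d) ∧ p c d) + 𝟙 ((toℕ c <ᵇ toℕ d) ∧ q c d)) ≡ edges p + edges q
edges-+ {n} p q = trans (sum-cong-≗ λ c → ∑-distrib-+ (P c) (Q c)) (∑-distrib-+ (sum ∘ P) (sum ∘ Q))
  where
  P Q : Fin n → Fin n → ℕ
  P c d = 𝟙 ((toℕ c <ᵇ toℕ d) ∧ p c d)
  Q c d = 𝟙 ((toℕ c <ᵇ toℕ d) ∧ q c d)

-- The hypotheses are restricted to `c ≢ d` for the sake of `fillPairs`, which holds on the diagonal
-- at every neighbour of the eliminated vertex; `edges` counts only pairs with `c` below `d`.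
edges-disjoint : ∀ {n} (p q r : Adj n) →
  (∀ {c d} → c ≢ d → p c d ≡ true → r c d ≡ true) →
  (∀ {c d} → c ≢ d → q c d ≡ true → r c d ≡ true) →
  (∀ {c d} → c ≢ d → p c d ≡ true → q c d ≡ true → ⊥) →
  edges p + edges q ≤ edges r
edges-disjoint {n} p q r p⊆r q⊆r p∩q =
  ≤-trans (≤-reflexive (sym (edges-+ p q))) (sum-mono λ c → sum-mono (bound c))
  where
  <ᵇ⇒≢ : ∀ {c d : Fin n} → (toℕ c <ᵇ toℕ d) ≡ true → c ≢ d
  <ᵇ⇒≢ {c} c<d refl = <-irrefl {toℕ c} refl (<ᵇ-true⁻ c<d)
  bound : ∀ c d →
    𝟙 ((toℕ c <ᵇ toℕ d) ∧ p c d) + 𝟙 ((toℕ c <ᵇ toℕ d) ∧ q c d) ≤ 𝟙 ((toℕ c <ᵇ toℕ d) ∧ r c d)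
  bound c d with toℕ c <ᵇ toℕ d in c<d
  ... | false = z≤n
  ... | true  = 𝟙-disjoint (p⊆r (<ᵇ⇒≢ c<d)) (q⊆r (<ᵇ⇒≢ c<d)) (p∩q (<ᵇ⇒≢ c<d))

edges-empty : ∀ {n} (p : Adj n) → (∀ {c d} → p c d ≢ true) → edges p ≡ 0
-- An empty relation is disjoint from itself, so its size m satisfies m + m ≤ m.
edges-empty p empty = n≤0⇒n≡0 (+-cancelʳ-≤ (edges p) (edges p) 0
  (edges-disjoint p p p (λ _ e → e) (λ _ e → e) λ _ e → ⊥-elim (empty e)))

edges-cover : ∀ {n} (p q r : Adj n) →
  (∀ {c d} → r c d ≡ true → p c d ≡ true ⊎ q c d ≡ true) →
  edges r ≤ edges p + edges q
edges-cover p q r cover =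
  ≤-trans (sum-mono λ c → sum-mono (bound c)) (≤-reflexive (edges-+ p q))
  where
  bound : ∀ c d →
    𝟙 ((toℕ c <ᵇ toℕ d) ∧ r c d) ≤ 𝟙 ((toℕ c <ᵇ toℕ d) ∧ p c d) + 𝟙 ((toℕ c <ᵇ toℕ d) ∧ q c d)
  bound c d with toℕ c <ᵇ toℕ d
  ... | false = z≤n
  ... | true  = 𝟙-cover cover

edges-mono : ∀ {n} (p q : Adj n) → (∀ {c d} → p c d ≡ true → q c d ≡ true) → edges p ≤ edges q
edges-mono p q p⊆q = sum-mono λ c → sum-mono (bound c)
  where
  bound : ∀ c d → 𝟙 ((toℕ c <ᵇ toℕ d) ∧ p c d) ≤ 𝟙 ((toℕ c <ᵇ toℕ d) ∧ q c d)
  bound c d with toℕ c <ᵇ toℕ d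
  ... | false = z≤n
  ... | true  = 𝟙-mono p⊆q

delete : ∀ {n} → Adj n → Fin n → Adj n
delete p u c d = p c d ∧ not ⌊ c ≟ u ⌋ ∧ not ⌊ d ≟ u ⌋

star : ∀ {n} → Adj n → Fin n → Fin n → ℕ
star p u d = 𝟙 (not ⌊ d ≟ u ⌋ ∧ p u d)

-- Among the pairs that meet `u`, `F` collects those with `u` as the smaller entry and `K` those
-- with `u` as the larger one; symmetry of `p` joins both into the degree of `u`.
edges-star : ∀ {n} (p : Adj n) → (∀ c d → p c d ≡ p d c) → ∀ u →
  edges p ≡ edges (delete p u) + sum (star p u)
edges-star {n} p p-sym u = begin
  edges p
    ≡⟨ sum-cong-≗ (λ c → sum-cong-≗ (split c)) ⟩
  (sum λ c → sum λ d → E c d + (F c d + K c d))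
    ≡⟨ sum-cong-≗ (λ c → trans (∑-distrib-+ (E c) _) (cong (sum (E c) +_) (∑-distrib-+ (F c) (K c)))) ⟩
  (sum λ c → sum (E c) + (sum (F c) + sum (K c)))
    ≡⟨ trans (∑-distrib-+ (sum ∘ E) _) (cong (edges (delete p u) +_) (∑-distrib-+ (sum ∘ F) (sum ∘ K))) ⟩
  edges (delete p u) + (sum (sum ∘ F) + sum (sum ∘ K))
    ≡⟨ cong (edges (delete p u) +_) (cong₂ _+_ (trans (∑-comm F) (sum-cong-≗ λ d → sum-δ u (λ _ → g d)))
                                              (sum-cong-≗ λ c → sum-δ u (λ _ → h c))) ⟩
  edges (delete p u) + (sum g + sum h)
    ≡⟨ cong (edges (delete p u) +_) (trans (sym (∑-distrib-+ g h)) (sum-cong-≗ g+h)) ⟩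
  edges (delete p u) + sum (star p u) ∎
  where
  open ≡-Reasoning
  g h : Fin n → ℕ
  g d = 𝟙 ((toℕ u <ᵇ toℕ d) ∧ p u d)
  h c = 𝟙 ((toℕ c <ᵇ toℕ u) ∧ p c u)
  E F K : Fin n → Fin n → ℕ
  E c d = 𝟙 ((toℕ c <ᵇ toℕ d) ∧ delete p u c d)
  F c d = 𝟙 ⌊ c ≟ u ⌋ * g d
  K c d = 𝟙 ⌊ d ≟ u ⌋ * h c
  n≮n : ∀ (c : Fin n) → (toℕ c <ᵇ toℕ c) ≡ false
  n≮n c = <ᵇ-false {toℕ c} (<-irrefl refl)
  split : ∀ c d → 𝟙 ((toℕ c <ᵇ toℕ d) ∧ p c d) ≡ E c d + (F c d + K c d)
  split c d with c ≟ u | d ≟ u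
  ... | yes refl | yes refl rewrite n≮n c = refl
  ... | yes refl | no _ rewrite Bool.∧-zeroʳ (p c d) | Bool.∧-zeroʳ (toℕ c <ᵇ toℕ d) =
    sym (trans (+-identityʳ _) (+-identityʳ _))
  ... | no _ | yes refl rewrite Bool.∧-zeroʳ (p c d) | Bool.∧-zeroʳ (toℕ c <ᵇ toℕ d) = sym (+-identityʳ _)
  ... | no _ | no _ rewrite Bool.∧-comm (p c d) true = sym (+-identityʳ _)
  g+h : ∀ d → g d + h d ≡ star p u d
  g+h d with d ≟ u
  ... | yes refl rewrite n≮n d = refl
  ... | no d≢u with <-cmp (toℕ d) (toℕ u)
  ...   | tri< d<u _ u≮d rewrite <ᵇ-true d<u | <ᵇ-false u≮d = cong 𝟙 (p-sym d u)
  ...   | tri≈ _ d≡u _ = ⊥-elim (d≢u (toℕ-injective d≡u))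
  ...   | tri> d≮u _ u<d rewrite <ᵇ-true u<d | <ᵇ-false d≮u = +-identityʳ _

infixl 6 _∖_

_∖_ : ∀ {n} → Adj n → Adj n → Adj n
(H ∖ A) c d = H c d ∧ not (A c d)

∖⁻ : ∀ {n} (H A : Adj n) {c d} → (H ∖ A) c d ≡ true → H c d ≡ true × A c d ≢ true
∖⁻ H A e = proj₁ (∧-true⁻ e) , not-true⁻ (proj₂ (∧-true⁻ {H _ _} e))

∖⁺ : ∀ {n} (H A : Adj n) {c d} → H c d ≡ true → A c d ≢ true → (H ∖ A) c d ≡ true
∖⁺ H A h a = ∧-true⁺ h (not-true⁺ a)

-- Triangulations and perfect elimination orders

infix 4 _⊑_

_⊑_ : ∀ {n} → Adj n → Adj n → Set
A ⊑ B = ∀ {c d} → A c d ≡ true → B c d ≡ true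

record Simple {n} (A : Adj n) : Set where
  field
    symm : ∀ {c d} → A c d ≡ true → A d c ≡ true
    irr  : ∀ {c} → A c c ≢ true

open Simple

-- Eliminated vertices stay in `Fin n` as isolated ones; this is the invariant that all other
-- vertices are still to be listed.
Covers : ∀ {n} → List (Fin n) → Adj n → Set
Covers L A = ∀ {c d} → A c d ≡ true → c ∈ L

-- A chordal supergraph with a witnessing order. The order is an injective rank with gaps allowed,
-- so that it can be altered by composing functions.
record Triangulation {n} (A : Adj n) : Set where
  field
    H              : Adj n
    simple         : Simple H
    contains       : A ⊑ H
    rank           : Fin n → ℕ
    rank-injective : ∀ {c d} → rank c ≡ rank d → c ≡ d
    perfect        : ∀ {x c d} → rank x < rank c → rank x < rank d → c ≢ d →
                     H x c ≡ true → H x d ≡ true → H c d ≡ true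

  fill : ℕ
  fill = edges (H ∖ A)

data Perfect {n} (H : Adj n) : List (Fin n) → Set where
  []  : Perfect H []
  _∷_ : ∀ {x L} →
        (∀ {c d} → c ∈ L → d ∈ L → c ≢ d → H x c ≡ true → H x d ≡ true → H c d ≡ true) →
        Perfect H L → Perfect H (x ∷ L)

-- Elimination

delete⁻ : ∀ {n} (H : Adj n) x {c d} → delete H x c d ≡ true → H c d ≡ true × c ≢ x × d ≢ x
delete⁻ H x {c} {d} e with ∧-true⁻ {H c d} e
... | h , f with ∧-true⁻ {not ⌊ c ≟ x ⌋} f
...   | p , q = h , not⌊⌋-true⁻ p , not⌊⌋-true⁻ q

delete⁺ : ∀ {n} (H : Adj n) x {c d} → H c d ≡ true → c ≢ x → d ≢ x → delete H x c d ≡ true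
delete⁺ H x {c} {d} h p q = ∧-true⁺ h (∧-true⁺ {not ⌊ c ≟ x ⌋} {not ⌊ d ≟ x ⌋} (not⌊⌋-true⁺ p) (not⌊⌋-true⁺ q))

delete-simple : ∀ {n} {H : Adj n} x → Simple H → Simple (delete H x)
delete-simple {H = H} x S = record
  { symm = λ e → let h , p , q = delete⁻ H x e in delete⁺ H x (symm S h) q p
  ; irr  = λ e → irr S (proj₁ (delete⁻ H x e))
  }

eliminate⁻ : ∀ {n} (A : Adj n) x {c d} → eliminate A x c d ≡ true →
  (A c d ≡ true ⊎ (A x c ≡ true × A x d ≡ true × c ≢ d)) × c ≢ x × d ≢ x
eliminate⁻ A x {c} {d} e with ∧-true⁻ {A c d ∨ _} e
... | h , f with ∧-true⁻ {not ⌊ c ≟ x ⌋} f | ∨-true⁻ {A c d} h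
...   | p , q | inj₁ a = inj₁ a , not⌊⌋-true⁻ p , not⌊⌋-true⁻ q
...   | p , q | inj₂ a with ∧-true⁻ {A x c} a
...     | xc , b with ∧-true⁻ {A x d} b
...       | xd , c≢d = inj₂ (xc , xd , not⌊⌋-true⁻ c≢d) , not⌊⌋-true⁻ p , not⌊⌋-true⁻ q

eliminate⁺ : ∀ {n} (A : Adj n) x {c d} →
  (A c d ≡ true ⊎ (A x c ≡ true × A x d ≡ true × c ≢ d)) → c ≢ x → d ≢ x →
  eliminate A x c d ≡ true
eliminate⁺ A x {c} {d} a p q =
  ∧-true⁺ (∨-true⁺ {A c d} (new a)) (∧-true⁺ {not ⌊ c ≟ x ⌋} {not ⌊ d ≟ x ⌋} (not⌊⌋-true⁺ p) (not⌊⌋-true⁺ q))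
  where
  new : (A c d ≡ true ⊎ (A x c ≡ true × A x d ≡ true × c ≢ d)) →
        A c d ≡ true ⊎ A x c ∧ A x d ∧ not ⌊ c ≟ d ⌋ ≡ true
  new (inj₁ cd)              = inj₁ cd
  new (inj₂ (xc , xd , c≢d)) = inj₂ (∧-true⁺ xc (∧-true⁺ xd (not⌊⌋-true⁺ c≢d)))

eliminate-simple : ∀ {n} {A : Adj n} x → Simple A → Simple (eliminate A x)
eliminate-simple {A = A} x S = record { symm = sy ; irr = ir }
  where
  sy : ∀ {c d} → eliminate A x c d ≡ true → eliminate A x d c ≡ true
  sy e with eliminate⁻ A x e
  ... | inj₁ a , p , q               = eliminate⁺ A x (inj₁ (symm S a)) q p
  ... | inj₂ (xc , xd , c≢d) , p , q = eliminate⁺ A x (inj₂ (xd , xc , ≢-sym c≢d)) q p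
  ir : ∀ {c} → eliminate A x c c ≢ true
  ir e with eliminate⁻ A x e
  ... | inj₁ a , _               = irr S a
  ... | inj₂ (_ , _ , c≢c) , _ = c≢c refl

eliminate-covers : ∀ {n} {A : Adj n} {x L} → Simple A → Covers (x ∷ L) A → Covers L (eliminate A x)
eliminate-covers {A = A} {x} {L} S cov e with eliminate⁻ A x e
... | a , c≢x , _ = strip (member a)
  where
  member : ∀ {c d} → A c d ≡ true ⊎ (A x c ≡ true × A x d ≡ true × c ≢ d) → c ∈ x ∷ L
  member (inj₁ cd)           = cov cd
  member (inj₂ (xc , _ , _)) = cov (symm S xc)
  strip : _ ∈ x ∷ L → _ ∈ L
  strip (here c≡x) = ⊥-elim (c≢x c≡x)
  strip (there p)  = p

fillPairs : ∀ {n} → Adj n → Fin n → Adj n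
fillPairs A x c d = A x c ∧ A x d ∧ not (A c d)

fillPairs⁻ : ∀ {n} (A : Adj n) x {c d} → fillPairs A x c d ≡ true →
  A x c ≡ true × A x d ≡ true × A c d ≢ true
fillPairs⁻ A x {c} {d} e with ∧-true⁻ {A x c} e
... | xc , f with ∧-true⁻ {A x d} f
...   | xd , g = xc , xd , not-true⁻ g

deficiency-edges : ∀ {n} (A : Adj n) x → deficiency A x ≡ edges (fillPairs A x)
deficiency-edges A x = count-pairs λ { (c , d) → fillPairs A x c d }

-- The pairs filled at `x` lie in `H` and are present after the elimination, so they are disjoint
-- from what is still missing. `H` has to be isolated at `x`: an edge of `A` at `x` would be missing
-- after the elimination, but not before.
deficiency-step : ∀ {n} {A H : Adj n} {x} → Simple A → eliminate A x ⊑ H →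
  (∀ {c d} → H c d ≡ true → c ≢ x × d ≢ x) →
  deficiency A x + edges (H ∖ eliminate A x) ≤ edges (H ∖ A)
deficiency-step {A = A} {H} {x} S A⊑H isolated =
  subst (λ m → m + edges (H ∖ eliminate A x) ≤ edges (H ∖ A)) (sym (deficiency-edges A x))
    (edges-disjoint (fillPairs A x) (H ∖ eliminate A x) (H ∖ A) new old disj)
  where
  ≢x : ∀ {c} → A x c ≡ true → c ≢ x
  ≢x xc refl = irr S xc
  filled : ∀ {c d} → c ≢ d → fillPairs A x c d ≡ true → eliminate A x c d ≡ true
  filled c≢d e with fillPairs⁻ A x e
  ... | xc , xd , _ = eliminate⁺ A x (inj₂ (xc , xd , c≢d)) (≢x xc) (≢x xd)
  new : ∀ {c d} → c ≢ d → fillPairs A x c d ≡ true → (H ∖ A) c d ≡ true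
  new c≢d e = ∖⁺ H A (A⊑H (filled c≢d e)) (proj₂ (proj₂ (fillPairs⁻ A x e)))
  old : ∀ {c d} → c ≢ d → (H ∖ eliminate A x) c d ≡ true → (H ∖ A) c d ≡ true
  old _ e with ∖⁻ H (eliminate A x) e
  ... | h , ¬a = ∖⁺ H A h λ a → ¬a (eliminate⁺ A x (inj₁ a) (proj₁ (isolated h)) (proj₂ (isolated h)))
  disj : ∀ {c d} → c ≢ d → fillPairs A x c d ≡ true → (H ∖ eliminate A x) c d ≡ true → ⊥
  disj c≢d e f = proj₂ (∖⁻ H (eliminate A x) f) (filled c≢d e)

-- Along a perfect order of `H` elimination never leaves `H`: the neighbours of `x` in `A` are later
-- neighbours in `H`, hence already a clique there. The induction passes to `delete H x`, which is
-- isolated at `x` as `deficiency-step` demands.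
fillList-bound : ∀ {n} {H : Adj n} L A → Simple A → A ⊑ H → Covers L A → Perfect H L →
  fillList A L ≤ edges (H ∖ A)
fillList-bound [] A S A⊑H cov perf = z≤n
fillList-bound {H = H} (x ∷ L) A S A⊑H cov (px ∷ perf) = begin
  deficiency A x + fillList (eliminate A x) L
    ≤⟨ +-monoʳ-≤ (deficiency A x)
         (fillList-bound L (eliminate A x) (eliminate-simple x S) sub (eliminate-covers S cov) (del perf)) ⟩
  deficiency A x + edges (delete H x ∖ eliminate A x)
    ≤⟨ deficiency-step S sub (λ e → proj₂ (delete⁻ H x e)) ⟩
  edges (delete H x ∖ A)
    ≤⟨ edges-mono (delete H x ∖ A) (H ∖ A) (λ e → let h , ¬a = ∖⁻ (delete H x) A e in ∖⁺ H A (proj₁ (delete⁻ H x h)) ¬a) ⟩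
  edges (H ∖ A) ∎
  where
  open ≤-Reasoning
  in-tail : ∀ {c} → A x c ≡ true → c ∈ L
  in-tail xc with cov (symm S xc)
  ... | here refl = ⊥-elim (irr S xc)
  ... | there p   = p
  sub : eliminate A x ⊑ delete H x
  sub e with eliminate⁻ A x e
  ... | inj₁ a , p , q = delete⁺ H x (A⊑H a) p q
  ... | inj₂ (xc , xd , c≢d) , p , q =
    delete⁺ H x (px (in-tail xc) (in-tail xd) c≢d (A⊑H xc) (A⊑H xd)) p q
  del : ∀ {M} → Perfect H M → Perfect (delete H x) M
  del [] = []
  del (py ∷ perf) =
    (λ c∈ d∈ c≢d yc yd → let h , _ , p = delete⁻ H x yc ; h′ , _ , q = delete⁻ H x yd in
      delete⁺ H x (py c∈ d∈ c≢d h h′) p q) ∷ del perf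

rankFirst : ∀ {n} → Fin n → (Fin n → ℕ) → Fin n → ℕ
rankFirst x r v = if ⌊ v ≟ x ⌋ then 0 else suc (r v)

module _ {n} {x : Fin n} {r : Fin n → ℕ} where

  rankFirst-≢ : ∀ {v w} → rankFirst x r v < rankFirst x r w → w ≢ x
  rankFirst-≢ {v} {w} lt refl with w ≟ w
  rankFirst-≢ {v} {w} () refl | yes _
  ... | no w≢w = w≢w refl

  rankFirst-< : ∀ {v w} → v ≢ x → w ≢ x → rankFirst x r v < rankFirst x r w → r v < r w
  rankFirst-< {v} {w} v≢x w≢x lt with v ≟ x | w ≟ x
  ... | yes p | _     = ⊥-elim (v≢x p)
  ... | no _  | yes p = ⊥-elim (w≢x p)
  ... | no _  | no _  = s<s⁻¹ lt

  rankFirst-injective : ∀ {v w} → (r v ≡ r w → v ≡ w) → rankFirst x r v ≡ rankFirst x r w → v ≡ w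
  rankFirst-injective {v} {w} inj e with v ≟ x | w ≟ x
  ... | yes p | yes q = trans p (sym q)
  ... | no _  | no _  = inj (suc-injective e)

-- The triangulation is the union of all graphs met during the elimination. The middle component
-- strengthens the induction: vertices isolated in the graph remain isolated in its triangulation,
-- so the triangulation of `eliminate A x` adds no edge at `x`.
fillList-triangulation : ∀ {n} L (A : Adj n) → Simple A → Covers L A →
  Σ (Triangulation A) λ T → let open Triangulation T in
    (∀ {c d} → H c d ≡ true → ∃ λ e → A c e ≡ true) × fill ≤ fillList A L
fillList-triangulation {n} [] A S cov = T , (λ {_} {d} e → d , e) ,
  ≤-reflexive (edges-empty (A ∖ A) λ e → let a , ¬a = ∖⁻ A A e in ¬a a)
  where
  T : Triangulation A
  T = record
    { H = A ; simple = S ; contains = λ a → a ; rank = toℕ ; rank-injective = toℕ-injective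
    ; perfect = λ _ _ _ xc _ → ⊥-elim (¬Any[] (cov xc)) }
fillList-triangulation {n} (x ∷ L) A S cov = T , touched , bound
  where
  Aₓ : Adj n
  Aₓ = eliminate A x
  IH = fillList-triangulation L Aₓ (eliminate-simple x S) (eliminate-covers S cov)
  module T₀ = Triangulation (proj₁ IH)
  K : Adj n
  K c d = A c d ∨ T₀.H c d
  K⁻ : ∀ {c d} → K c d ≡ true → A c d ≡ true ⊎ T₀.H c d ≡ true
  K⁻ {c} {d} = ∨-true⁻ {A c d}
  at-x : ∀ {d} → K x d ≡ true → A x d ≡ true
  at-x e with K⁻ e
  ... | inj₁ a = a
  ... | inj₂ h = ⊥-elim (proj₁ (proj₂ (eliminate⁻ A x (proj₂ (proj₁ (proj₂ IH) h)))) refl)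
  off-x : ∀ {c d} → c ≢ x → d ≢ x → K c d ≡ true → T₀.H c d ≡ true
  off-x c≢x d≢x e with K⁻ e
  ... | inj₁ a = T₀.contains (eliminate⁺ A x (inj₁ a) c≢x d≢x)
  ... | inj₂ h = h
  K-perfect : ∀ {y c d} → rankFirst x T₀.rank y < rankFirst x T₀.rank c →
    rankFirst x T₀.rank y < rankFirst x T₀.rank d → c ≢ d →
    K y c ≡ true → K y d ≡ true → K c d ≡ true
  K-perfect {y} {c} {d} y<c y<d c≢d yc yd = ∨-true⁺ {A c d} (inj₂ (clique (y ≟ x)))
    where
    c≢x : c ≢ x
    c≢x = rankFirst-≢ {v = y} y<c
    d≢x : d ≢ x
    d≢x = rankFirst-≢ {v = y} y<d
    clique : Dec (y ≡ x) → T₀.H c d ≡ true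
    clique (yes refl) =
      T₀.contains (eliminate⁺ A x (inj₂ (at-x yc , at-x yd , c≢d)) c≢x d≢x)
    clique (no y≢x) =
      T₀.perfect (rankFirst-< y≢x c≢x y<c) (rankFirst-< y≢x d≢x y<d) c≢d
        (off-x y≢x c≢x yc) (off-x y≢x d≢x yd)
  T : Triangulation A
  T = record
    { H = K
    ; simple = record
      { symm = λ {c} {d} e → ∨-true⁺ {A d c} (Sum.map (symm S) (symm T₀.simple) (K⁻ e))
      ; irr = λ e → [ irr S , irr T₀.simple ] (K⁻ e) }
    ; contains = λ a → ∨-true⁺ (inj₁ a)
    ; rank = rankFirst x T₀.rank
    ; rank-injective = rankFirst-injective T₀.rank-injective
    ; perfect = K-perfect
    }
  touched : ∀ {c d} → K c d ≡ true → ∃ λ e → A c e ≡ true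
  touched {c} {d} e with K⁻ e
  ... | inj₁ a = d , a
  ... | inj₂ h with proj₁ (proj₂ IH) h
  ...   | e′ , a with eliminate⁻ A x a
  ...     | inj₁ ce , _             = e′ , ce
  ...     | inj₂ (xc , _ , _) , _ = x , symm S xc
  cover : ∀ {c d} → (K ∖ A) c d ≡ true → fillPairs A x c d ≡ true ⊎ (T₀.H ∖ Aₓ) c d ≡ true
  cover {c} {d} e with ∖⁻ K A e
  ... | k , ¬a with K⁻ k | Aₓ c d Bool.≟ true
  ...   | inj₁ a | _     = ⊥-elim (¬a a)
  ...   | inj₂ h | no ¬b = inj₂ (∖⁺ T₀.H Aₓ h ¬b)
  ...   | inj₂ h | yes b with proj₁ (eliminate⁻ A x b)
  ...     | inj₁ a             = ⊥-elim (¬a a)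
  ...     | inj₂ (xc , xd , _) = inj₁ (∧-true⁺ xc (∧-true⁺ xd (not-true⁺ ¬a)))
  bound : edges (K ∖ A) ≤ deficiency A x + fillList Aₓ L
  bound = begin
    edges (K ∖ A)                            ≤⟨ edges-cover (fillPairs A x) (T₀.H ∖ Aₓ) (K ∖ A) cover ⟩
    edges (fillPairs A x) + edges (T₀.H ∖ Aₓ) ≡⟨ cong (_+ T₀.fill) (sym (deficiency-edges A x)) ⟩
    deficiency A x + T₀.fill                 ≤⟨ +-monoʳ-≤ (deficiency A x) (proj₂ (proj₂ IH)) ⟩
    deficiency A x + fillList Aₓ L           ∎
    where open ≤-Reasoning

-- Lists sorted by rank

Unique-↭ : ∀ {A : Set} {L M : List A} → L ↭ M → Unique L → Unique M
Unique-↭ {A} L↭M = SetoidPerm.Unique-resp-↭ (setoid A) (↭⇒↭ₛ L↭M)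

sortBy : ∀ {n} (r : Fin n → ℕ) → (∀ {c d} → r c ≡ r d → c ≡ d) → ∀ {L} → Unique L →
  ∃ λ M → M ↭ L × AllPairs (λ c d → r c < r d) M
sortBy r inj {L} uniq = S.sort L , S.sort-↭ L , strict (Sorted⇒AllPairs O.totalOrder (S.sort-↗ L)) uniq′
  where
  module O = DecTotalOrder (On.decTotalOrder ≤-decTotalOrder r)
  module S = Data.List.Sort (On.decTotalOrder ≤-decTotalOrder r)
  uniq′ : Unique (S.sort L)
  uniq′ = Unique-↭ (↭-sym (S.sort-↭ L)) uniq
  strict : ∀ {M} → AllPairs (λ c d → r c ≤ r d) M → Unique M → AllPairs (λ c d → r c < r d) M
  strict le ne = AllPairs.zipWith (λ (p , q) → ≤∧≢⇒< p (q ∘ inj)) (le , ne)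

module _ {n} {A : Adj n} (T : Triangulation A) where
  open Triangulation T

  sorted⇒Perfect : ∀ {M} → AllPairs (λ c d → rank c < rank d) M → Perfect H M
  sorted⇒Perfect []           = []
  sorted⇒Perfect (x< ∷ sorted) =
    (λ c∈ d∈ → perfect (All.lookup x< c∈) (All.lookup x< d∈)) ∷ sorted⇒Perfect sorted

-- Contracting an edge of a triangulation

-- The merged vertex is called `u`, and `v` survives as an isolated vertex, just as after
-- `eliminate A v`, which the result is to contain.
contract : ∀ {n} → Adj n → Fin n → Fin n → Adj n
contract H u v c d =
  (not ⌊ c ≟ v ⌋ ∧ not ⌊ d ≟ v ⌋ ∧ not ⌊ c ≟ d ⌋) ∧
  (H c d ∨ (⌊ c ≟ u ⌋ ∧ H v d) ∨ (⌊ d ≟ u ⌋ ∧ H c v))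

Merged : ∀ {n} → Adj n → Fin n → Fin n → Fin n → Fin n → Set
Merged H u v c d = H c d ≡ true ⊎ (c ≡ u × H v d ≡ true) ⊎ (d ≡ u × H c v ≡ true)

contract⁻ : ∀ {n} (H : Adj n) u v {c d} → contract H u v c d ≡ true →
  c ≢ v × d ≢ v × c ≢ d × Merged H u v c d
contract⁻ H u v {c} {d} e
  with ∧-true⁻ {not ⌊ c ≟ v ⌋ ∧ not ⌊ d ≟ v ⌋ ∧ not ⌊ c ≟ d ⌋} e
... | f , g with ∧-true⁻ {not ⌊ c ≟ v ⌋} f
...   | p , f′ with ∧-true⁻ {not ⌊ d ≟ v ⌋} f′
...     | q , r = not⌊⌋-true⁻ p , not⌊⌋-true⁻ q , not⌊⌋-true⁻ r , merged (∨-true⁻ {H c d} g)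
  where
  merged : H c d ≡ true ⊎ (⌊ c ≟ u ⌋ ∧ H v d) ∨ (⌊ d ≟ u ⌋ ∧ H c v) ≡ true → Merged H u v c d
  merged (inj₁ h) = inj₁ h
  merged (inj₂ h) with ∨-true⁻ {⌊ c ≟ u ⌋ ∧ H v d} h
  ... | inj₁ k = let a , b = ∧-true⁻ {⌊ c ≟ u ⌋} k in inj₂ (inj₁ (⌊⌋-true⁻ a , b))
  ... | inj₂ k = let a , b = ∧-true⁻ {⌊ d ≟ u ⌋} k in inj₂ (inj₂ (⌊⌋-true⁻ a , b))

contract⁺ : ∀ {n} (H : Adj n) u v {c d} → c ≢ v → d ≢ v → c ≢ d → Merged H u v c d →
  contract H u v c d ≡ true
contract⁺ H u v {c} {d} p q r m =
  ∧-true⁺ {not ⌊ c ≟ v ⌋ ∧ not ⌊ d ≟ v ⌋ ∧ not ⌊ c ≟ d ⌋}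
    (∧-true⁺ {not ⌊ c ≟ v ⌋} {not ⌊ d ≟ v ⌋ ∧ not ⌊ c ≟ d ⌋} (not⌊⌋-true⁺ p)
      (∧-true⁺ {not ⌊ d ≟ v ⌋} {not ⌊ c ≟ d ⌋} (not⌊⌋-true⁺ q) (not⌊⌋-true⁺ r)))
    (∨-true⁺ {H c d} (merged m))
  where
  merged : Merged H u v c d → H c d ≡ true ⊎ (⌊ c ≟ u ⌋ ∧ H v d) ∨ (⌊ d ≟ u ⌋ ∧ H c v) ≡ true
  merged (inj₁ h)              = inj₁ h
  merged (inj₂ (inj₁ (a , b))) =
    inj₂ (∨-true⁺ {⌊ c ≟ u ⌋ ∧ H v d} (inj₁ (∧-true⁺ {⌊ c ≟ u ⌋} (⌊⌋-true⁺ a) b)))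
  merged (inj₂ (inj₂ (a , b))) =
    inj₂ (∨-true⁺ {⌊ c ≟ u ⌋ ∧ H v d} (inj₂ (∧-true⁺ {⌊ d ≟ u ⌋} (⌊⌋-true⁺ a) b)))

sum-𝟙≟ : ∀ {n} (x : Fin n) → sum (λ d → 𝟙 ⌊ d ≟ x ⌋) ≡ 1
sum-𝟙≟ x = trans (sum-cong-≗ λ d → sym (*-identityʳ (𝟙 ⌊ d ≟ x ⌋))) (sum-δ x (λ _ → 1))

transpose-fst : ∀ {n} (u v : Fin n) → transpose u v ⟨$⟩ʳ u ≡ v
transpose-fst u v with u ≟ u
... | yes _  = refl
... | no u≢u = ⊥-elim (u≢u refl)

transpose-other : ∀ {n} (u v : Fin n) {y} → y ≢ u → y ≢ v → transpose u v ⟨$⟩ʳ y ≡ y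
transpose-other u v {y} y≢u y≢v with y ≟ u
... | yes p = ⊥-elim (y≢u p)
... | no _ with y ≟ v
...   | yes p = ⊥-elim (y≢v p)
...   | no _  = refl

simple-≡ : ∀ {n} {p : Adj n} → Simple p → ∀ c d → p c d ≡ p d c
simple-≡ S c d = true⇔⇒≡ (symm S) (symm S)

∖-simple : ∀ {n} {H A : Adj n} → Simple H → Simple A → Simple (H ∖ A)
∖-simple {H = H} {A} SH SA = record
  { symm = λ e → let h , ¬a = ∖⁻ H A e in ∖⁺ H A (symm SH h) (¬a ∘ symm SA)
  ; irr  = λ e → irr SH (proj₁ (∖⁻ H A e))
  }

simple-≢ : ∀ {n} {A : Adj n} → Simple A → ∀ {c d} → A c d ≡ true → c ≢ d
simple-≢ S e refl = irr S e

module Contraction {n} {A : Adj n} (S : Simple A) (T : Triangulation A) {u v w : Fin n}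
  (uv : Triangulation.H T u v ≡ true)
  (nbr : ∀ {d} → A v d ≡ true → d ≡ u ⊎ d ≡ w) where

  open Triangulation T

  K : Adj n
  K = contract H u v

  u≢v : u ≢ v
  u≢v = simple-≢ simple uv

  K⁻u : ∀ {d} → K u d ≡ true → H u d ≡ true ⊎ H v d ≡ true
  K⁻u e with contract⁻ H u v e
  ... | _ , _ , u≢d , inj₁ h              = inj₁ h
  ... | _ , _ , u≢d , inj₂ (inj₁ (_ , h)) = inj₂ h
  ... | _ , _ , u≢d , inj₂ (inj₂ (d≡u , _)) = ⊥-elim (u≢d (sym d≡u))

  K⁺u : ∀ {d} → d ≢ u → d ≢ v → H u d ≡ true ⊎ H v d ≡ true → K u d ≡ true
  K⁺u d≢u d≢v (inj₁ h) = contract⁺ H u v u≢v d≢v (≢-sym d≢u) (inj₁ h)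
  K⁺u d≢u d≢v (inj₂ h) = contract⁺ H u v u≢v d≢v (≢-sym d≢u) (inj₂ (inj₁ (refl , h)))

  K⁻off : ∀ {c d} → c ≢ u → d ≢ u → K c d ≡ true → H c d ≡ true
  K⁻off c≢u d≢u e with contract⁻ H u v e
  ... | _ , _ , _ , inj₁ h              = h
  ... | _ , _ , _ , inj₂ (inj₁ (p , _)) = ⊥-elim (c≢u p)
  ... | _ , _ , _ , inj₂ (inj₂ (p , _)) = ⊥-elim (d≢u p)

  K-isolated : ∀ {c d} → K c d ≡ true → c ≢ v × d ≢ v
  K-isolated e = let p , q , _ = contract⁻ H u v e in p , q

  K-simple : Simple K
  K-simple = record { symm = sy ; irr = λ e → proj₁ (proj₂ (proj₂ (contract⁻ H u v e))) refl }
    where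
    sy : ∀ {c d} → K c d ≡ true → K d c ≡ true
    sy e with contract⁻ H u v e
    ... | p , q , r , inj₁ h              = contract⁺ H u v q p (≢-sym r) (inj₁ (symm simple h))
    ... | p , q , r , inj₂ (inj₁ (a , h)) =
      contract⁺ H u v q p (≢-sym r) (inj₂ (inj₂ (a , symm simple h)))
    ... | p , q , r , inj₂ (inj₂ (a , h)) =
      contract⁺ H u v q p (≢-sym r) (inj₂ (inj₁ (a , symm simple h)))

  K-contains : eliminate A v ⊑ K
  K-contains e with eliminate⁻ A v e
  ... | inj₁ a , p , q =
    contract⁺ H u v p q (simple-≢ S a) (inj₁ (contains a))
  ... | inj₂ (vc , vd , c≢d) , p , q with nbr vc | nbr vd
  ...   | inj₁ c≡u | _        = contract⁺ H u v p q c≢d (inj₂ (inj₁ (c≡u , contains vd)))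
  ...   | _        | inj₁ d≡u = contract⁺ H u v p q c≢d (inj₂ (inj₂ (d≡u , symm simple (contains vc))))
  ...   | inj₂ c≡w | inj₂ d≡w = ⊥-elim (c≢d (trans c≡w (sym d≡w)))

  -- The merged vertex takes the place of the later endpoint l of the contracted edge: the later
  -- neighbours of the earlier endpoint e are already neighbours of l.
  K-perfect : ∀ (r : Fin n → ℕ) e l →
    (∀ {d} → H u d ≡ true ⊎ H v d ≡ true → H e d ≡ true ⊎ H l d ≡ true) →
    (∀ {d} → H e d ≡ true ⊎ H l d ≡ true → H u d ≡ true ⊎ H v d ≡ true) →
    (∀ {d} → d ≢ u → d ≢ v → d ≢ e × d ≢ l) →
    H e l ≡ true → rank e < rank l → r u ≡ rank l →
    (∀ {d} → d ≢ u → d ≢ v → r d ≡ rank d) →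
    ∀ {x c d} → r x < r c → r x < r d → c ≢ d → K x c ≡ true → K x d ≡ true → K c d ≡ true
  K-perfect r e l to from other el e<l ru rd = perf
    where
    later : ∀ {y} → y ≢ u → y ≢ v → rank e < rank y → H e y ≡ true ⊎ H l y ≡ true → H l y ≡ true
    later y≢u y≢v e<y (inj₁ h) = perfect e<l e<y (≢-sym (proj₂ (other y≢u y≢v))) el h
    later y≢u y≢v e<y (inj₂ h) = h

    -- Here `x` precedes both the merged vertex and `d`. If `x` comes after `e`, then `later` makes
    -- it a neighbour of `l`; otherwise its neighbour among `e` and `l` is itself later than `x`. In
    -- each case an endpoint of the contracted edge and `d` are later neighbours of `x` in `H`.
    toward : ∀ {x d} → x ≢ u → x ≢ v → d ≢ u → d ≢ v → rank x < rank l → rank x < rank d →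
      H e x ≡ true ⊎ H l x ≡ true → H x d ≡ true → K u d ≡ true
    toward {x} {d} x≢u x≢v d≢u d≢v x<l x<d near xd = K⁺u d≢u d≢v (from (meet (<-cmp (rank x) (rank e)) near))
      where
      via : ∀ {y} → y ≢ d → rank x < rank y → H y x ≡ true → H y d ≡ true
      via y≢d x<y yx = perfect x<y x<d y≢d (symm simple yx) xd
      d≢e = proj₁ (other d≢u d≢v)
      d≢l = proj₂ (other d≢u d≢v)
      meet : _ → H e x ≡ true ⊎ H l x ≡ true → H e d ≡ true ⊎ H l d ≡ true
      meet _              (inj₂ lx) = inj₂ (via (≢-sym d≢l) x<l lx)
      meet (tri< x<e _ _) (inj₁ ex) = inj₁ (via (≢-sym d≢e) x<e ex)
      meet (tri≈ _ x≡e _) (inj₁ ex) = ⊥-elim (proj₁ (other x≢u x≢v) (rank-injective x≡e))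
      meet (tri> _ _ e<x) (inj₁ ex) = inj₂ (via (≢-sym d≢l) x<l (later x≢u x≢v e<x (inj₁ ex)))

    perf : ∀ {x c d} → r x < r c → r x < r d → c ≢ d → K x c ≡ true → K x d ≡ true → K c d ≡ true
    perf {x} {c} {d} x<c x<d c≢d xc xd = go (x ≟ u) (c ≟ u) (d ≟ u)
      where
      x≢v = proj₁ (K-isolated xc)
      c≢v = proj₂ (K-isolated xc)
      d≢v = proj₂ (K-isolated xd)
      <r : ∀ {y} {m : ℕ} → r x ≡ m → y ≢ u → y ≢ v → r x < r y → m < rank y
      <r refl y≢u y≢v lt = subst (r x <_) (rd y≢u y≢v) lt
      <u : x ≢ u → ∀ {y} → y ≡ u → r x < r y → rank x < rank l
      <u x≢u refl lt = subst₂ _<_ (rd x≢u x≢v) ru lt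
      go : Dec (x ≡ u) → Dec (c ≡ u) → Dec (d ≡ u) → K c d ≡ true
      go (yes refl) _ _ = contract⁺ H u v c≢v d≢v c≢d (inj₁
          (perfect l<c l<d c≢d (later c≢u c≢v (<-trans e<l l<c) (to (K⁻u xc)))
                               (later d≢u d≢v (<-trans e<l l<d) (to (K⁻u xd)))))
        where
        c≢u = ≢-sym (simple-≢ K-simple xc)
        d≢u = ≢-sym (simple-≢ K-simple xd)
        l<c = <r ru c≢u c≢v x<c
        l<d = <r ru d≢u d≢v x<d
      go (no x≢u) (yes refl) (yes refl) = ⊥-elim (c≢d refl)
      go (no x≢u) (yes refl) (no d≢u) =
        toward x≢u x≢v d≢u d≢v (<u x≢u refl x<c) (<r (rd x≢u x≢v) d≢u d≢v x<d)
          (to (K⁻u (symm K-simple xc))) (K⁻off x≢u d≢u xd)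
      go (no x≢u) (no c≢u) (yes refl) = symm K-simple
        (toward x≢u x≢v c≢u c≢v (<u x≢u refl x<d) (<r (rd x≢u x≢v) c≢u c≢v x<c)
          (to (K⁻u (symm K-simple xd))) (K⁻off x≢u c≢u xc))
      go (no x≢u) (no c≢u) (no d≢u) = contract⁺ H u v c≢v d≢v c≢d (inj₁
        (perfect (<r (rd x≢u x≢v) c≢u c≢v x<c) (<r (rd x≢u x≢v) d≢u d≢v x<d) c≢d
          (K⁻off x≢u c≢u xc) (K⁻off x≢u d≢u xd)))

  contracted : Triangulation (eliminate A v)
  contracted with <-cmp (rank u) (rank v)
  ... | tri≈ _ u≡v _ = ⊥-elim (u≢v (rank-injective u≡v))
  ... | tri> _ _ v<u = record
    { H = K ; simple = K-simple ; contains = K-contains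
    ; rank = rank ; rank-injective = rank-injective
    ; perfect = K-perfect rank v u Sum.swap Sum.swap (λ p q → q , p) (symm simple uv) v<u refl (λ _ _ → refl)
    }
  -- The later endpoint is `v`, so `u` must take over its rank. Exchanging the two ranks keeps them
  -- injective, and the new rank of the isolated vertex `v` does no harm.
  ... | tri< u<v _ _ = record
    { H = K ; simple = K-simple ; contains = K-contains
    ; rank = rank ∘ (transpose u v ⟨$⟩ʳ_)
    ; rank-injective = Injection.injective (↔⇒↣ (transpose u v)) ∘ rank-injective
    ; perfect = K-perfect (rank ∘ (transpose u v ⟨$⟩ʳ_)) u v id id _,_ uv u<v
        (cong rank (transpose-fst u v)) (λ p q → cong rank (transpose-other u v p q))
    }

  contracted-H : Triangulation.H contracted ≡ K
  contracted-H with <-cmp (rank u) (rank v)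
  ... | tri≈ _ u≡v _ = ⊥-elim (u≢v (rank-injective u≡v))
  ... | tri> _ _ _   = refl
  ... | tri< _ _ _   = refl

  private
    KA HA : Adj n
    KA = K ∖ A
    HA = H ∖ A

    HA-simple : Simple HA
    HA-simple = ∖-simple simple S

    atV : Fin n → ℕ
    atV = star (delete HA u) v

    -- A fill edge ud of `K` stems from a fill edge ud or vd of `H`, unless it stems from an edge vd
    -- of `A`; the hypothesis disposes of that case.
    star-bound : ∀ {d} → (H v d ≡ true → A v d ≡ true → d ≢ u → H u d ≡ true) →
      star KA u d ≤ star HA u d + atV d
    star-bound {d} absorb = 𝟙-cover split
      where
      split : not ⌊ d ≟ u ⌋ ∧ KA u d ≡ true →
        not ⌊ d ≟ u ⌋ ∧ HA u d ≡ true ⊎ not ⌊ d ≟ v ⌋ ∧ delete HA u v d ≡ true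
      split e with ∧-true⁻ {not ⌊ d ≟ u ⌋} e
      ... | p , f with ∖⁻ K A f | not⌊⌋-true⁻ {P? = d ≟ u} p
      ...   | k , ¬a | d≢u with K⁻u k | A v d Bool.≟ true
      ...     | inj₁ h | _      = inj₁ (∧-true⁺ p (∖⁺ H A h ¬a))
      ...     | inj₂ h | yes vd = inj₁ (∧-true⁺ p (∖⁺ H A (absorb h vd d≢u) ¬a))
      ...     | inj₂ h | no ¬vd = inj₂ (∧-true⁺ {not ⌊ d ≟ v ⌋} (not⌊⌋-true⁺ (proj₂ (K-isolated k)))
                  (delete⁺ HA u (∖⁺ H A h ¬vd) (≢-sym u≢v) d≢u))

    -- Away from `u` and `v` every edge of `K` is one of `H`, so only the edges at these two
    -- vertices need comparing. Those of `H` at `v` are counted after deleting `u`, so that uv is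
    -- not counted twice.
    merge-bound : sum (star KA u) ≤ sum (star HA u) + sum atV → edges KA ≤ edges HA
    merge-bound le = begin
      edges KA
        ≡⟨ edges-star KA (simple-≡ (∖-simple K-simple S)) u ⟩
      edges (delete KA u) + sum (star KA u)
        ≤⟨ +-mono-≤ (edges-mono (delete KA u) (delete (delete HA u) v) inner) le ⟩
      edges (delete (delete HA u) v) + (sum (star HA u) + sum atV)
        ≡⟨ trans (cong (edges (delete (delete HA u) v) +_) (+-comm (sum (star HA u)) (sum atV)))
                 (sym (+-assoc (edges (delete (delete HA u) v)) (sum atV) (sum (star HA u)))) ⟩
      edges (delete (delete HA u) v) + sum atV + sum (star HA u)
        ≡⟨ cong (_+ sum (star HA u)) (sym (edges-star (delete HA u) (simple-≡ (delete-simple u HA-simple)) v)) ⟩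
      edges (delete HA u) + sum (star HA u)
        ≡⟨ sym (edges-star HA (simple-≡ HA-simple) u) ⟩
      edges HA ∎
      where
      open ≤-Reasoning
      inner : ∀ {c d} → delete KA u c d ≡ true → delete (delete HA u) v c d ≡ true
      inner e with delete⁻ KA u e
      ... | ka , c≢u , d≢u with ∖⁻ K A ka
      ...   | k , ¬a = delete⁺ (delete HA u) v
                (delete⁺ HA u (∖⁺ H A (K⁻off c≢u d≢u k) ¬a) c≢u d≢u)
                (proj₁ (K-isolated k)) (proj₂ (K-isolated k))

  -- Apart from uv itself, the only edge of `A` that moves is vw; it becomes a loop, which is
  -- dropped, or an edge that `H` already has.
  fill-closed : u ≡ w ⊎ H u w ≡ true → edges (K ∖ A) ≤ edges (H ∖ A)
  fill-closed cl = merge-bound (≤-trans (sum-mono {f = star KA u} {g = λ d → star HA u d + atV d} λ d → star-bound {d} (absorb cl))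
                                        (≤-reflexive (∑-distrib-+ (star HA u) atV)))
    where
    absorb : u ≡ w ⊎ H u w ≡ true → ∀ {d} → H v d ≡ true → A v d ≡ true → d ≢ u → H u d ≡ true
    absorb (inj₁ refl) _ vd d≢u = ⊥-elim ([ d≢u , d≢u ] (nbr vd))
    absorb (inj₂ uw)   _ vd d≢u with nbr vd
    ... | inj₁ d≡u  = ⊥-elim (d≢u d≡u)
    ... | inj₂ refl = uw

  -- Contraction merges the edges ux and vx, which pays for the edge uw it creates.
  fill-common : ∀ {x} → x ≢ w → H u x ≡ true → H v x ≡ true → edges (K ∖ A) ≤ edges (H ∖ A)
  fill-common {x} x≢w ux vx = merge-bound (+-cancelʳ-≤ 1 (sum (star KA u)) (sum (star HA u) + sum atV) (begin
    sum (star KA u) + 1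
      ≡⟨ cong (sum (star KA u) +_) (sym (sum-𝟙≟ x)) ⟩
    sum (star KA u) + sum (λ d → 𝟙 ⌊ d ≟ x ⌋)
      ≡⟨ sym (∑-distrib-+ (star KA u) (λ d → 𝟙 ⌊ d ≟ x ⌋)) ⟩
    sum (λ d → star KA u d + 𝟙 ⌊ d ≟ x ⌋)
      ≤⟨ sum-mono bound ⟩
    sum (λ d → star HA u d + atV d + 𝟙 ⌊ d ≟ w ⌋)
      ≡⟨ ∑-distrib-+ (λ d → star HA u d + atV d) (λ d → 𝟙 ⌊ d ≟ w ⌋) ⟩
    sum (λ d → star HA u d + atV d) + sum (λ d → 𝟙 ⌊ d ≟ w ⌋)
      ≡⟨ cong₂ _+_ (∑-distrib-+ (star HA u) atV) (sum-𝟙≟ w) ⟩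
    sum (star HA u) + sum atV + 1 ∎))
    where
    open ≤-Reasoning
    x≢u = ≢-sym (simple-≢ simple ux)
    x≢v = ≢-sym (simple-≢ simple vx)
    atV-x : atV x ≡ 1
    atV-x = cong 𝟙 (∧-true⁺ {not ⌊ x ≟ v ⌋} (not⌊⌋-true⁺ x≢v)
      (delete⁺ HA u (∖⁺ H A vx (λ a → [ x≢u , x≢w ] (nbr a))) (≢-sym u≢v) x≢u))
    keep : not ⌊ x ≟ u ⌋ ∧ KA u x ≡ true → not ⌊ x ≟ u ⌋ ∧ HA u x ≡ true
    keep e with ∧-true⁻ {not ⌊ x ≟ u ⌋} e
    ... | p , f = ∧-true⁺ p (∖⁺ H A ux (proj₂ (∖⁻ K A f)))
    star≤1 : ∀ d → star KA u d ≤ 1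
    star≤1 d = 𝟙-mono {b = true} λ _ → refl
    -- One unit is added at `x` on the left and at `w` on the right: at `x` the vanished fill edge
    -- vx leaves room for it, and at `w` it covers the possibly new edge uw.
    bound : ∀ d → star KA u d + 𝟙 ⌊ d ≟ x ⌋ ≤ star HA u d + atV d + 𝟙 ⌊ d ≟ w ⌋
    bound d = go (d ≟ x) (d ≟ w)
      where
      go : (p : Dec (d ≡ x)) (q : Dec (d ≡ w)) →
        star KA u d + 𝟙 ⌊ p ⌋ ≤ star HA u d + atV d + 𝟙 ⌊ q ⌋
      go (yes refl) q = ≤-trans (+-mono-≤ (𝟙-mono keep) (≤-reflexive (sym atV-x))) (m≤m+n _ (𝟙 ⌊ q ⌋))
      go (no _) (yes refl) = ≤-trans (≤-reflexive (+-identityʳ _)) (≤-trans (star≤1 d) (m≤n+m 1 _))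
      go (no _) (no d≢w) = subst₂ _≤_ (sym (+-identityʳ _)) (sym (+-identityʳ _))
        (star-bound λ _ vd d≢u → ⊥-elim ([ d≢u , d≢w ] (nbr vd)))

-- Bridges

Separates : ∀ {n} → Adj n → (u v : Fin n) → (Fin n → Bool) → Set
Separates A u v S = S u ≡ true × S v ≢ true ×
  (∀ {c d} → S c ≡ true → S d ≢ true → A c d ≡ true → c ≡ u × d ≡ v)

module _ {n} {H : Adj n} (SH : Simple H) {u v : Fin n} (uv : H u v ≡ true)
  (alone : ∀ {x} → H u x ≡ true → H v x ≢ true) where

  SeparatesOn : List (Fin n) → (Fin n → Bool) → Set
  SeparatesOn L S = S u ≡ true × S v ≢ true ×
    (∀ {c d} → c ∈ L → d ∈ L → S c ≡ true → S d ≢ true → H c d ≡ true → c ≡ u × d ≡ v)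

  -- If the first vertex is `u` or `v`, the other is its only neighbour in the list, since a further
  -- one would be a common neighbour; that vertex alone forms one side. Any other first vertex `x`
  -- joins the side of its later neighbours: they form a clique, and a clique on both sides would
  -- contain `u` and `v`, making `x` a common neighbour.
  bridge-list : ∀ {L} → Unique L → Perfect H L → u ∈ L → v ∈ L → ∃ (SeparatesOn L)
  bridge-list {x ∷ L} (x∉L ∷ uniq) (px ∷ perf) u∈ v∈ = go u∈ v∈
    where
    u≢v : u ≢ v
    u≢v = simple-≢ SH uv
    go : u ∈ x ∷ L → v ∈ x ∷ L → ∃ (SeparatesOn (x ∷ L))
    go (here refl) (here refl) = ⊥-elim (u≢v refl)
    go (here refl) (there v∈L) = (λ c → ⌊ c ≟ u ⌋) , ⌊⌋-true⁺ refl , (u≢v ∘ sym ∘ ⌊⌋-true⁻) , cross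
      where
      cross : ∀ {c d} → c ∈ u ∷ L → d ∈ u ∷ L → ⌊ c ≟ u ⌋ ≡ true → ⌊ d ≟ u ⌋ ≢ true →
        H c d ≡ true → c ≡ u × d ≡ v
      cross {c} {d} _ d∈ c≡u d≢u cd with ⌊⌋-true⁻ {P? = c ≟ u} c≡u | d∈ | d ≟ v
      ... | refl | _         | yes d≡v = refl , d≡v
      ... | refl | here refl | no _    = ⊥-elim (irr SH cd)
      ... | refl | there d∈L | no d≢v  =
        ⊥-elim (alone cd (symm SH (px d∈L v∈L d≢v cd uv)))
    go (there u∈L) (here refl) =
      (λ c → not ⌊ c ≟ v ⌋) , not⌊⌋-true⁺ u≢v , (λ e → not⌊⌋-true⁻ {P? = v ≟ v} e refl) , cross
      where
      cross : ∀ {c d} → c ∈ v ∷ L → d ∈ v ∷ L → not ⌊ c ≟ v ⌋ ≡ true → not ⌊ d ≟ v ⌋ ≢ true →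
        H c d ≡ true → c ≡ u × d ≡ v
      cross {c} {d} c∈ _ c≢v ¬d≢v cd with d ≟ v | c∈ | c ≟ u
      ... | no _     | _         | _       = ⊥-elim (¬d≢v refl)
      ... | yes refl | _         | yes c≡u = c≡u , refl
      ... | yes refl | here refl | no _    = ⊥-elim (irr SH cd)
      ... | yes refl | there c∈L | no c≢u  =
        ⊥-elim (alone (symm SH (px c∈L u∈L c≢u (symm SH cd) (symm SH uv))) (symm SH cd))
    go (there u∈L) (there v∈L) = S′ , trans (keep u∈L) Su , (λ e → ¬Sv (trans (sym (keep v∈L)) e)) , cross
      where
      IH = bridge-list uniq perf u∈L v∈L
      S = proj₁ IH
      Su = proj₁ (proj₂ IH)
      ¬Sv = proj₁ (proj₂ (proj₂ IH))
      crossL = proj₂ (proj₂ (proj₂ IH))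
      side : Dec (Any.Any (λ c → S c ∧ H x c ≡ true) L)
      side = Any.any? (λ c → S c ∧ H x c Bool.≟ true) L
      S′ : Fin n → Bool
      S′ c = if ⌊ c ≟ x ⌋ then ⌊ side ⌋ else S c
      keep : ∀ {c} → c ∈ L → S′ c ≡ S c
      keep {c} c∈L with c ≟ x
      ... | yes refl = ⊥-elim (All.lookup x∉L c∈L refl)
      ... | no _     = refl
      at-x : S′ x ≡ ⌊ side ⌋
      at-x with x ≟ x
      ... | yes _  = refl
      ... | no x≢x = ⊥-elim (x≢x refl)
      cross : ∀ {c d} → c ∈ x ∷ L → d ∈ x ∷ L → S′ c ≡ true → S′ d ≢ true → H c d ≡ true → c ≡ u × d ≡ v
      cross (here refl) (here refl) _ _ cd = ⊥-elim (irr SH cd)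
      cross (there c∈L) (there d∈L) Sc ¬Sd cd =
        crossL c∈L d∈L (trans (sym (keep c∈L)) Sc) (λ e → ¬Sd (trans (keep d∈L) e)) cd
      cross {d = d} (here refl) (there d∈L) Sx ¬Sd xd
        with find (⌊⌋-true⁻ {P? = side} (trans (sym at-x) Sx))
      ... | c , c∈L , e with ∧-true⁻ {S c} e
      ...   | Sc , xc = ⊥-elim (clash (crossL c∈L d∈L Sc ¬S₀d (px c∈L d∈L c≢d xc xd)))
        where
        ¬S₀d : S d ≢ true
        ¬S₀d e = ¬Sd (trans (keep d∈L) e)
        c≢d : c ≢ d
        c≢d refl = ¬S₀d Sc
        clash : c ≡ u × d ≡ v → ⊥
        clash (refl , refl) = alone (symm SH xc) (symm SH xd)
      cross (there c∈L) (here refl) Sc ¬Sx cx = ⊥-elim (¬Sx (trans at-x (⌊⌋-true⁺ {P? = side}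
        (lose c∈L (∧-true⁺ (trans (sym (keep c∈L)) Sc) (symm SH cx))))))

bridge : ∀ {n} {A : Adj n} (T : Triangulation A) → let open Triangulation T in
  ∀ {u v} → H u v ≡ true → (∀ {x} → H u x ≡ true → H v x ≢ true) → ∃ (Separates H u v)
bridge {n} T {u} {v} uv alone =
  let M , M↭ , sorted = sortBy rank rank-injective (Unique.allFin⁺ n)
      ∈M = λ c → ∈-resp-↭ (↭-sym M↭) (∈-allFin c)
      S , Su , ¬Sv , cross = bridge-list simple uv alone
        (AllPairs.map (λ { lt refl → <-irrefl refl lt }) sorted) (sorted⇒Perfect T sorted) (∈M u) (∈M v)
  in S , Su , ¬Sv , λ {c} {d} → cross (∈M c) (∈M d)
  where open Triangulation T

-- Changing the last vertex of a perfect elimination order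

rankFirst-self : ∀ {n} (x : Fin n) r → rankFirst x r x ≡ 0
rankFirst-self x r with x ≟ x
... | yes _  = refl
... | no x≢x = ⊥-elim (x≢x refl)

rankFirst-other : ∀ {n} {x y : Fin n} r → y ≢ x → rankFirst x r y ≡ suc (r y)
rankFirst-other {x = x} {y} r y≢x with y ≟ x
... | yes p = ⊥-elim (y≢x p)
... | no _  = refl

-- Everything is relative to `L` because the induction runs over the suffixes of a perfect order.
-- `bound` gives the room to shift a block of vertices behind all others.
record EndingIn {n} (H : Adj n) (K : Fin n → Bool) (L : List (Fin n)) : Set where
  field
    rank      : Fin n → ℕ
    bound     : ℕ
    bounded   : ∀ {c} → c ∈ L → rank c < bound
    injective : ∀ {c d} → c ∈ L → d ∈ L → rank c ≡ rank d → c ≡ d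
    perfect   : ∀ {x c d} → x ∈ L → c ∈ L → d ∈ L → rank x < rank c → rank x < rank d → c ≢ d →
                H x c ≡ true → H x d ≡ true → H c d ≡ true
    last      : ∀ {c d} → c ∈ L → d ∈ L → K c ≢ true → K d ≡ true → rank c < rank d

module _ {n} {H : Adj n} (SH : Simple H) {x : Fin n} {L} (x∉L : All (x ≢_) L)
  (px : ∀ {c d} → c ∈ L → d ∈ L → c ≢ d → H x c ≡ true → H x d ≡ true → H c d ≡ true)
  {K : Fin n → Bool} where

  prepend : K x ≢ true → EndingIn H K L → EndingIn H K (x ∷ L)
  prepend ¬Kx E = record
    { rank = r ; bound = suc IH.bound
    ; bounded = bd ; injective = inj ; perfect = pf ; last = ls }
    where
    module IH = EndingIn E
    r = rankFirst x IH.rank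
    other : ∀ {c} → c ∈ L → r c ≡ suc (IH.rank c)
    other c∈ = rankFirst-other IH.rank (λ { refl → All.lookup x∉L c∈ refl })
    tail : ∀ {c} → c ≢ x → c ∈ x ∷ L → c ∈ L
    tail c≢x (here p)   = ⊥-elim (c≢x p)
    tail c≢x (there c∈) = c∈
    bd : ∀ {c} → c ∈ x ∷ L → r c < suc IH.bound
    bd (here refl) = subst (_< suc IH.bound) (sym (rankFirst-self x IH.rank)) z<s
    bd (there c∈)  = subst (_< suc IH.bound) (sym (other c∈)) (s<s (IH.bounded c∈))
    inj : ∀ {c d} → c ∈ x ∷ L → d ∈ x ∷ L → r c ≡ r d → c ≡ d
    inj (here refl) (here refl) e = refl
    inj (here refl) (there d∈)  e = ⊥-elim (0≢1+n (trans (sym (rankFirst-self x IH.rank)) (trans e (other d∈))))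
    inj (there c∈)  (here refl) e = ⊥-elim (0≢1+n (trans (sym (rankFirst-self x IH.rank)) (trans (sym e) (other c∈))))
    inj (there c∈)  (there d∈)  e = rankFirst-injective {x = x} (IH.injective c∈ d∈) e
    pf : ∀ {y c d} → y ∈ x ∷ L → c ∈ x ∷ L → d ∈ x ∷ L → r y < r c → r y < r d → c ≢ d →
      H y c ≡ true → H y d ≡ true → H c d ≡ true
    pf {y} y∈ c∈ d∈ y<c y<d with tail (rankFirst-≢ {v = y} y<c) c∈ | tail (rankFirst-≢ {v = y} y<d) d∈ | y∈
    ... | c∈L | d∈L | here refl = px c∈L d∈L
    ... | c∈L | d∈L | there y∈L = IH.perfect y∈L c∈L d∈L (less c∈L y<c) (less d∈L y<d)
      where
      less : ∀ {c} → c ∈ L → r y < r c → IH.rank y < IH.rank c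
      less c∈ lt = s<s⁻¹ (subst₂ _<_ (other y∈L) (other c∈) lt)
    ls : ∀ {c d} → c ∈ x ∷ L → d ∈ x ∷ L → K c ≢ true → K d ≡ true → r c < r d
    ls _           (here refl) ¬Kc Kd = ⊥-elim (¬Kx Kd)
    ls (here refl) (there d∈)  ¬Kc Kd = subst₂ _<_ (sym (rankFirst-self x IH.rank)) (sym (other d∈)) z<s
    ls (there c∈)  (there d∈)  ¬Kc Kd = subst₂ _<_ (sym (other c∈)) (sym (other d∈)) (s<s (IH.last c∈ d∈ ¬Kc Kd))

  -- The new order is: non-neighbours of `x`, neighbours outside `K`, the rest of `K`, and `x`. The
  -- rest of `K` consists of neighbours of `x`, since `K` is a clique. So all that follows a
  -- neighbour of `x` in `L` is again a neighbour, and such neighbours form a clique by `px`; for a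
  -- non-neighbour, later in the new order implies later in the old one.
  postpone : K x ≡ true →
    (∀ {c d} → c ∈ x ∷ L → d ∈ x ∷ L → c ≢ d → K c ≡ true → K d ≡ true → H c d ≡ true) →
    EndingIn H (H x) L → EndingIn H K (x ∷ L)
  postpone Kx clique E = record
    { rank = r ; bound = suc (B + B)
    ; bounded = bd ; injective = inj ; perfect = pf ; last = ls }
    where
    module IH = EndingIn E
    B = IH.bound
    r : Fin n → ℕ
    -- Ranks outside `K` stay below `B`, those in `K` fall into the interval from `B` up to but
    -- excluding `B + B`.
    r c = if ⌊ c ≟ x ⌋ then B + B else (if K c then B + IH.rank c else IH.rank c)
    r-x : r x ≡ B + B
    r-x with x ≟ x
    ... | yes _  = refl
    ... | no x≢x = ⊥-elim (x≢x refl)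
    ≢x : ∀ {c} → c ∈ L → c ≢ x
    ≢x c∈ refl = All.lookup x∉L c∈ refl
    r-in : ∀ {c} → c ∈ L → K c ≡ true → r c ≡ B + IH.rank c
    r-in {c} c∈ Kc with c ≟ x
    ... | yes p = ⊥-elim (≢x c∈ p)
    ... | no _ rewrite Kc = refl
    r-out : ∀ {c} → c ∈ L → K c ≢ true → r c ≡ IH.rank c
    r-out {c} c∈ ¬Kc with c ≟ x
    ... | yes p = ⊥-elim (≢x c∈ p)
    ... | no _ with K c
    ...   | true  = ⊥-elim (¬Kc refl)
    ...   | false = refl
    r<x : ∀ {c} → c ∈ L → r c < r x
    r<x {c} c∈ with K c Bool.≟ true
    ... | yes Kc = subst₂ _<_ (sym (r-in c∈ Kc)) (sym r-x) (+-monoʳ-< B (IH.bounded c∈))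
    ... | no ¬Kc = subst₂ _<_ (sym (r-out c∈ ¬Kc)) (sym r-x) (<-≤-trans (IH.bounded c∈) (m≤m+n B B))
    out<in : ∀ {c d} → c ∈ L → d ∈ L → K c ≢ true → K d ≡ true → r c < r d
    out<in c∈ d∈ ¬Kc Kd = subst₂ _<_ (sym (r-out c∈ ¬Kc)) (sym (r-in d∈ Kd))
      (<-≤-trans (IH.bounded c∈) (m≤m+n B _))
    bd : ∀ {c} → c ∈ x ∷ L → r c < suc (B + B)
    bd (here refl) = subst (_< suc (B + B)) (sym r-x) (n<1+n _)
    bd {c} (there c∈) = m<n⇒m<1+n (subst (r c <_) r-x (r<x c∈))
    inj : ∀ {c d} → c ∈ x ∷ L → d ∈ x ∷ L → r c ≡ r d → c ≡ d
    inj (here refl) (here refl) e = refl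
    inj (here refl) (there d∈)  e = ⊥-elim (<⇒≢ (r<x d∈) (sym e))
    inj (there c∈)  (here refl) e = ⊥-elim (<⇒≢ (r<x c∈) e)
    inj {c} {d} (there c∈) (there d∈) e with K c Bool.≟ true | K d Bool.≟ true
    ... | yes Kc | yes Kd = IH.injective c∈ d∈ (+-cancelˡ-≡ B _ _ (trans (sym (r-in c∈ Kc)) (trans e (r-in d∈ Kd))))
    ... | no ¬Kc | no ¬Kd = IH.injective c∈ d∈ (trans (sym (r-out c∈ ¬Kc)) (trans e (r-out d∈ ¬Kd)))
    ... | no ¬Kc | yes Kd = ⊥-elim (<⇒≢ (out<in c∈ d∈ ¬Kc Kd) e)
    ... | yes Kc | no ¬Kd = ⊥-elim (<⇒≢ (out<in d∈ c∈ ¬Kd Kc) (sym e))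
    K⇒nbr : ∀ {c} → c ∈ L → K c ≡ true → H x c ≡ true
    K⇒nbr c∈ Kc = clique (here refl) (there c∈) (≢-sym (≢x c∈)) Kx Kc
    nbr-later : ∀ {y c} → y ∈ L → c ∈ L → H x y ≡ true → r y < r c → H x c ≡ true
    nbr-later {y} {c} y∈ c∈ xy y<c with K c Bool.≟ true | K y Bool.≟ true | H x c Bool.≟ true
    ... | _      | _      | yes xc = xc
    ... | yes Kc | _      | no _   = K⇒nbr c∈ Kc
    ... | no ¬Kc | yes Ky | no _   = ⊥-elim (<-asym y<c (out<in c∈ y∈ ¬Kc Ky))
    ... | no ¬Kc | no ¬Ky | no ¬xc = ⊥-elim (<-asym (subst₂ _<_ (r-out y∈ ¬Ky) (r-out c∈ ¬Kc) y<c) (IH.last c∈ y∈ ¬xc xy))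
    far-later : ∀ {y c} → y ∈ L → c ∈ L → H x y ≢ true → r y < r c → IH.rank y < IH.rank c
    far-later {y} {c} y∈ c∈ ¬xy y<c with K c Bool.≟ true | K y Bool.≟ true
    ... | _      | yes Ky = ⊥-elim (¬xy (K⇒nbr y∈ Ky))
    ... | yes Kc | no _   = IH.last y∈ c∈ ¬xy (K⇒nbr c∈ Kc)
    ... | no ¬Kc | no ¬Ky = subst₂ _<_ (r-out y∈ ¬Ky) (r-out c∈ ¬Kc) y<c
    x≮ : ∀ {c} → c ∈ x ∷ L → ¬ (r x < r c)
    x≮ (here refl) lt = <-irrefl refl lt
    x≮ (there c∈)  lt = <-asym lt (r<x c∈)
    pf : ∀ {y c d} → y ∈ x ∷ L → c ∈ x ∷ L → d ∈ x ∷ L → r y < r c → r y < r d → c ≢ d →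
      H y c ≡ true → H y d ≡ true → H c d ≡ true
    pf (here refl) c∈ d∈ y<c y<d c≢d yc yd = ⊥-elim (x≮ c∈ y<c)
    pf (there y∈) (here refl) (here refl) y<c y<d c≢d yc yd = ⊥-elim (c≢d refl)
    pf (there y∈) (here refl) (there d∈) y<c y<d c≢d yc yd = nbr-later y∈ d∈ (symm SH yc) y<d
    pf (there y∈) (there c∈) (here refl) y<c y<d c≢d yc yd = symm SH (nbr-later y∈ c∈ (symm SH yd) y<c)
    pf {y} (there y∈) (there c∈) (there d∈) y<c y<d c≢d yc yd with H x y Bool.≟ true
    ... | yes xy = px c∈ d∈ c≢d (nbr-later y∈ c∈ xy y<c) (nbr-later y∈ d∈ xy y<d)
    ... | no ¬xy = IH.perfect y∈ c∈ d∈ (far-later y∈ c∈ ¬xy y<c) (far-later y∈ d∈ ¬xy y<d) c≢d yc yd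
    ls : ∀ {c d} → c ∈ x ∷ L → d ∈ x ∷ L → K c ≢ true → K d ≡ true → r c < r d
    ls (here refl) _           ¬Kc Kd = ⊥-elim (¬Kc Kx)
    ls (there c∈)  (here refl) ¬Kc Kd = r<x c∈
    ls (there c∈)  (there d∈)  ¬Kc Kd = out<in c∈ d∈ ¬Kc Kd

-- If the first vertex x lies in K, first move the remaining neighbours of x, which form a clique
-- containing K ∖ {x}, to the end, and then K itself.
ending-in : ∀ {n} {H : Adj n} → Simple H → ∀ {L} → Unique L → Perfect H L → (K : Fin n → Bool) →
  (∀ {c d} → c ∈ L → d ∈ L → c ≢ d → K c ≡ true → K d ≡ true → H c d ≡ true) →
  EndingIn H K L
ending-in SH [] [] K clique = record
  { rank = λ _ → 0 ; bound = 0 ; bounded = λ () ; injective = λ () ; perfect = λ () ; last = λ () }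
ending-in {n} {H} SH {x ∷ L} (x∉L ∷ uniq) (px ∷ perf) K clique with K x Bool.≟ true
... | no ¬Kx = prepend SH x∉L px ¬Kx (ending-in SH uniq perf K (λ c∈ d∈ → clique (there c∈) (there d∈)))
... | yes Kx = postpone SH x∉L px Kx clique (ending-in SH uniq perf (H x) px)

sorted⇒Unique : ∀ {n} {r : Fin n → ℕ} {M} → AllPairs (λ c d → r c < r d) M → Unique M
sorted⇒Unique = AllPairs.map λ { lt refl → <-irrefl refl lt }

reroot : ∀ {n} {A : Adj n} (T : Triangulation A) (v : Fin n) → Σ (Triangulation A) λ T′ →
  Triangulation.H T′ ≡ Triangulation.H T ×
  (∀ {c} → c ≢ v → Triangulation.rank T′ c < Triangulation.rank T′ v)
reroot {n} T v = record
    { H = H ; simple = simple ; contains = contains ; rank = E.rank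
    ; rank-injective = E.injective (∈M _) (∈M _)
    ; perfect = E.perfect (∈M _) (∈M _) (∈M _) }
  , refl , λ c≢v → E.last (∈M _) (∈M _) (c≢v ∘ ⌊⌋-true⁻) (⌊⌋-true⁺ refl)
  where
  open Triangulation T
  ordered = sortBy rank rank-injective (Unique.allFin⁺ n)
  M = proj₁ ordered
  ∈M : ∀ c → c ∈ M
  ∈M c = ∈-resp-↭ (↭-sym (proj₁ (proj₂ ordered))) (∈-allFin c)
  module E = EndingIn (ending-in simple (sorted⇒Unique (proj₂ (proj₂ ordered)))
    (sorted⇒Perfect T (proj₂ (proj₂ ordered))) (λ c → ⌊ c ≟ v ⌋)
    (λ {c} {d} _ _ c≢d p q → ⊥-elim (c≢d (trans (⌊⌋-true⁻ {P? = c ≟ v} p) (sym (⌊⌋-true⁻ {P? = d ≟ v} q))))))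

-- Paths of vertices of degree two

-- The inner vertices of the path u , a 0 , … , a k are a 0 , … , a (k ∸ 1).
record InnerPath {n} (A : Adj n) (u : Fin n) (a : ℕ → Fin n) (k : ℕ) : Set where
  field
    distinct : ∀ {i j} → i < k → j < k → a i ≡ a j → i ≡ j
    start≢   : ∀ {i} → i < k → u ≢ a i
    end≢     : ∀ {i} → i < k → a k ≢ a i
    edge₀    : 0 < k → A u (a 0) ≡ true
    edge     : ∀ {i} → i < k → A (a i) (a (suc i)) ≡ true
    nbr₀     : ∀ {d} → 0 < k → A (a 0) d ≡ true → d ≡ u ⊎ d ≡ a 1
    nbr      : ∀ {i d} → suc i < k → A (a (suc i)) d ≡ true → d ≡ a i ⊎ d ≡ a (2 + i)

module _ {n} {A : Adj n} {u : Fin n} {a : ℕ → Fin n} {k : ℕ} (P : InnerPath A u a (suc k)) where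
  open InnerPath P

  ≢head : ∀ {i} → i < suc k → a (suc i) ≢ a 0
  ≢head {i} i<1+k e with m≤n⇒m<n∨m≡n i<1+k
  ... | inj₁ 1+i<1+k = 1+n≢0 (distinct 1+i<1+k z<s e)
  ... | inj₂ refl    = end≢ z<s e

  path-tail : InnerPath A (a 0) (a ∘ suc) k
  path-tail = record
    { distinct = λ p q e → suc-injective (distinct (s<s p) (s<s q) e)
    ; start≢   = λ p e → 0≢1+n (distinct z<s (s<s p) e)
    ; end≢     = λ p → end≢ (s<s p)
    ; edge₀    = λ _ → edge z<s
    ; edge     = λ p → edge (s<s p)
    ; nbr₀     = λ p → nbr (s<s p)
    ; nbr      = λ p → nbr (s<s p)
    }

  -- Eliminating `a 0` joins `u` to `a 1`. If no inner vertex remains, `u` and `a 1` may coincide,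
  -- as when the path closes up to a cycle; hence `edge₀` and `nbr₀` speak only of a nonempty path.
  path-eliminate : Simple A → InnerPath (eliminate A (a 0)) u (a ∘ suc) k
  path-eliminate S = record
    { distinct = λ p q e → suc-injective (distinct (s<s p) (s<s q) e)
    ; start≢   = λ p → start≢ (s<s p)
    ; end≢     = λ p → end≢ (s<s p)
    ; edge₀    = λ p → eliminate⁺ A (a 0)
        (inj₂ (symm S (edge₀ z<s) , edge z<s , start≢ (s<s p))) (start≢ z<s) (≢head z<s)
    ; edge     = λ p → eliminate⁺ A (a 0) (inj₁ (edge (s<s p))) (≢head (<-trans p (n<1+n k))) (≢head (s<s p))
    ; nbr₀     = first
    ; nbr      = next
    }
    where
    first : ∀ {d} → 0 < k → eliminate A (a 0) (a 1) d ≡ true → d ≡ u ⊎ d ≡ a 2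
    first p e with eliminate⁻ A (a 0) e
    first p e | inj₁ h , _ , d≢0 with nbr (s<s p) h
    ... | inj₁ d≡0 = ⊥-elim (d≢0 d≡0)
    ... | inj₂ d≡2 = inj₂ d≡2
    first p e | inj₂ (_ , h , 1≢d) , _ with nbr₀ z<s h
    ... | inj₁ d≡u = inj₁ d≡u
    ... | inj₂ d≡1 = ⊥-elim (1≢d (sym d≡1))
    next : ∀ {i d} → suc i < k → eliminate A (a 0) (a (2 + i)) d ≡ true → d ≡ a (suc i) ⊎ d ≡ a (3 + i)
    next p e with eliminate⁻ A (a 0) e
    ... | inj₁ h , _           = nbr (s<s p) h
    ... | inj₂ (h , _ , _) , _ with nbr₀ z<s h
    ...   | inj₁ e′ = ⊥-elim (start≢ (s<s p) (sym e′))
    ...   | inj₂ e′ = ⊥-elim (1+n≢0 (suc-injective (distinct (s<s p) (s<s (<-trans z<s p)) e′)))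

-- The start `u` stays fixed while the path shrinks, so a cut found after some eliminations can be
-- pulled back to `A` one vertex at a time. The component `u ≢ a 1` is carried along for this
-- purpose.
path-first-or-separated : ∀ {n} {u : Fin n} k a (A : Adj n) → Simple A → InnerPath A u a k →
  (T : Triangulation A) → ∀ {L} → Unique L → Covers (applyUpTo a k ++ L) A →
  (∃ λ M → M ↭ L × fillList A (applyUpTo a k ++ M) ≤ Triangulation.fill T) ⊎
  (0 < k × u ≢ a 1 × ∃ (Separates A u (a 0)))
path-first-or-separated zero a A S P T uniq cov =
  let M , M↭ , sorted = sortBy rank rank-injective uniq
  in inj₁ (M , M↭ , fillList-bound M A S contains (λ e → ∈-resp-↭ (↭-sym M↭) (cov e)) (sorted⇒Perfect T sorted))
  where open Triangulation T
path-first-or-separated {n} {u} (suc k) a A S P T {L} uniq cov = choose (u ≟ a 1) (H u (a 1) Bool.≟ true)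
  (any? λ x → (H u x Bool.≟ true) ×-dec (H (a 0) x Bool.≟ true))
  where
  open Triangulation T
  open InnerPath P
  open Contraction S T (contains (edge₀ z<s)) (nbr₀ z<s)
  v = a 0
  Result = (∃ λ M → M ↭ L × fillList A (applyUpTo a (suc k) ++ M) ≤ fill) ⊎
           (0 < suc k × u ≢ a 1 × ∃ (Separates A u v))
  -- `v` is put on the far side. Its neighbours are `u` and `a 1`, and `a 1` is already there. The
  -- old crossing edge from `u` to `a 1` is absent from `A`, where `a 1` has only the neighbours `v`
  -- and `a 2`, both different from `u`.
  lift : 0 < k → u ≢ a 2 → ∃ (Separates (eliminate A v) u (a 1)) → ∃ (Separates A u v)
  lift 0<k u≢2 (R , Ru , ¬R1 , cross) = R′ ,
    ∧-true⁺ Ru (not⌊⌋-true⁺ (start≢ z<s)) ,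
    (λ e → not⌊⌋-true⁻ {P? = v ≟ v} (proj₂ (∧-true⁻ {R v} e)) refl) , cross′
    where
    R′ : Fin n → Bool
    R′ c = R c ∧ not ⌊ c ≟ v ⌋
    cross′ : ∀ {c d} → R′ c ≡ true → R′ d ≢ true → A c d ≡ true → c ≡ u × d ≡ v
    cross′ {c} {d} R′c ¬R′d cd with ∧-true⁻ {R c} R′c | d ≟ v
    ... | Rc , c≢v | yes refl with nbr₀ z<s (symm S cd)
    ...   | inj₁ c≡u  = c≡u , refl
    ...   | inj₂ refl = ⊥-elim (¬R1 Rc)
    cross′ {c} {d} R′c ¬R′d cd | Rc , c≢v | no d≢v
      with cross Rc (λ Rd → ¬R′d (∧-true⁺ Rd refl))
                 (eliminate⁺ A v (inj₁ cd) (not⌊⌋-true⁻ c≢v) d≢v)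
    ...   | refl , refl with nbr (s<s 0<k) (symm S cd)
    ...     | inj₁ u≡v = ⊥-elim (start≢ z<s u≡v)
    ...     | inj₂ u≡2 = ⊥-elim (u≢2 u≡2)
  -- Both fills are measured over `A`, so the deficiency of `v` is paid by the passage from `A` to
  -- `eliminate A v` below the same `K`.
  recurse : edges (K ∖ A) ≤ edges (H ∖ A) → Result
  recurse le with path-first-or-separated k (a ∘ suc) (eliminate A v) (eliminate-simple v S)
                    (path-eliminate P S) contracted uniq (eliminate-covers S cov)
  ... | inj₂ (0<k , u≢2 , sep) = inj₂ (z<s , start≢ (s<s 0<k) , lift 0<k u≢2 sep)
  ... | inj₁ (M , M↭ , b) = inj₁ (M , M↭ , (begin
    deficiency A v + fillList (eliminate A v) (applyUpTo (a ∘ suc) k ++ M)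
      ≤⟨ +-monoʳ-≤ (deficiency A v) b ⟩
    deficiency A v + edges (Triangulation.H contracted ∖ eliminate A v)
      ≡⟨ cong (λ J → deficiency A v + edges (J ∖ eliminate A v)) contracted-H ⟩
    deficiency A v + edges (K ∖ eliminate A v)
      ≤⟨ deficiency-step S K-contains K-isolated ⟩
    edges (K ∖ A)
      ≤⟨ le ⟩
    edges (H ∖ A) ∎))
    where open ≤-Reasoning
  choose : Dec (u ≡ a 1) → Dec (H u (a 1) ≡ true) → Dec (∃ λ x → H u x ≡ true × H v x ≡ true) → Result
  choose (yes u≡w) _ _ = recurse (fill-closed (inj₁ u≡w))
  choose _ (yes uw) _ = recurse (fill-closed (inj₂ uw))
  choose _ (no ¬uw) (yes (x , ux , vx)) = recurse (fill-common (λ { refl → ¬uw ux }) ux vx)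
  choose (no u≢w) _ (no ¬common) with bridge T (contains (edge₀ z<s)) (λ ux vx → ¬common (_ , ux , vx))
  ... | R , Ru , ¬Rv , cross = inj₂ (z<s , u≢w , R , Ru , ¬Rv , λ Rc ¬Rd cd → cross Rc ¬Rd (contains cd))

-- Orders in which the path is consecutive

-- With the start `u` not among the remaining vertices, each path vertex has at most one later
-- neighbour, its successor; it then plays the role of `u` for the rest of the path.
path-perfect : ∀ {n} {A : Adj n} {u Y} k a → InnerPath A u a k → u ∉ Y → (∀ {i} → i < k → a i ∉ Y) →
  Perfect A Y → Perfect A (applyUpTo a k ++ Y)
path-perfect zero a P u∉Y a∉Y perf = perf
path-perfect {A = A} {u} {Y} (suc k) a P u∉Y a∉Y perf =
  (λ c∈ d∈ c≢d ac ad → ⊥-elim (c≢d (trans (next c∈ ac) (sym (next d∈ ad))))) ∷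
  path-perfect k (a ∘ suc) (path-tail P) (a∉Y z<s) (λ p → a∉Y (s<s p)) perf
  where
  open InnerPath P
  next : ∀ {c} → c ∈ applyUpTo (a ∘ suc) k ++ Y → A (a 0) c ≡ true → c ≡ a 1
  next c∈ ac with nbr₀ z<s ac
  ... | inj₂ c≡1 = c≡1
  ... | inj₁ refl with ∈-++⁻ (applyUpTo (a ∘ suc) k) c∈
  ...   | inj₂ u∈Y = ⊥-elim (u∉Y u∈Y)
  ...   | inj₁ u∈a = let i , i<k , e = ∈-applyUpTo⁻ (a ∘ suc) u∈a in ⊥-elim (start≢ (s<s i<k) e)

PathOrder : ∀ {n} → (ℕ → Fin n) → ℕ → (List (Fin n) → Set) → Set
PathOrder a k Q = ∃₂ λ X Y → let L = X ++ applyUpTo a k ++ Y in Unique L × (∀ v → v ∈ L) × Q L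

module _ {n} {A : Adj n} (S : Simple A) {u : Fin n} {a : ℕ → Fin n} {k : ℕ} (P : InnerPath A u a k)
  (T : Triangulation A) where
  open InnerPath P
  open Triangulation T
  open DecMembership (_≟_ {n}) using (_∈?_)

  private
    Pₗ : List (Fin n)
    Pₗ = applyUpTo a k

    Pₗ-unique : Unique Pₗ
    Pₗ-unique = Unique.applyUpTo⁺₁ a k λ i<j j<k e → <⇒≢ i<j (distinct (<-trans i<j j<k) j<k e)

  -- When u and a k are separated by the path, every vertex on the side of u is eliminated before
  -- the path, u being the last of them; this uses only edges of H.
  separated-order : ∀ {R} → 0 < k → Separates A u (a 0) R → PathOrder a k λ L → fillList A L ≤ fill
  separated-order {R} 0<k (Ru , ¬Ra₀ , cross) = X , Y , unique , complete , (begin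
      fillList A (X ++ Pₗ ++ Y) ≤⟨ fillList-bound (X ++ Pₗ ++ Y) A S A⊑J (λ _ → complete _) J-perfect ⟩
      edges (J ∖ A)             ≤⟨ edges-mono (J ∖ A) (H ∖ A) (λ e → let j , ¬a = ∖⁻ J A e in ∖⁺ H A (J⊑H j) ¬a) ⟩
      edges (H ∖ A)             ∎)
    where
    open ≤-Reasoning
    module T′ = Triangulation (proj₁ (reroot T u))
    H′≡H : T′.H ≡ H
    H′≡H = proj₁ (proj₂ (reroot T u))
    inY? : ∀ c → Dec (R c ≢ true × c ∉ Pₗ)
    inY? c = ¬? (R c Bool.≟ true) ×-dec ¬? (c ∈? Pₗ)
    sortedX = sortBy T′.rank T′.rank-injective (Unique.filter⁺ (λ c → R c Bool.≟ true) (Unique.allFin⁺ n))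
    sortedY = sortBy rank rank-injective (Unique.filter⁺ inY? (Unique.allFin⁺ n))
    X = proj₁ sortedX
    Y = proj₁ sortedY
    X⁻ : ∀ {c} → c ∈ X → R c ≡ true
    X⁻ c∈ = proj₂ (∈-filter⁻ (λ c → R c Bool.≟ true) {xs = allFin n} (∈-resp-↭ (proj₁ (proj₂ sortedX)) c∈))
    Y⁻ : ∀ {c} → c ∈ Y → R c ≢ true × c ∉ Pₗ
    Y⁻ c∈ = proj₂ (∈-filter⁻ inY? {xs = allFin n} (∈-resp-↭ (proj₁ (proj₂ sortedY)) c∈))
    -- The first path vertex inside `R` would have an edge to its predecessor outside, and the only
    -- vertex of `R` with such an edge is `u`.
    a∉R : ∀ i → i < k → R (a i) ≢ true
    a∉R zero    _    Ra = ¬Ra₀ Ra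
    a∉R (suc i) 1+i<k Ra = start≢ 1+i<k (sym (proj₁ (cross Ra (a∉R i i<k) (symm S (edge i<k)))))
      where i<k = <-trans (n<1+n i) 1+i<k
    P⁻ : ∀ {c} → c ∈ Pₗ → R c ≢ true
    P⁻ c∈ with ∈-applyUpTo⁻ a c∈
    ... | i , i<k , refl = a∉R i i<k
    rest⁻ : ∀ {c} → c ∈ Pₗ ++ Y → R c ≢ true
    rest⁻ c∈ = [ P⁻ , (λ c∈Y → proj₁ (Y⁻ c∈Y)) ] (∈-++⁻ Pₗ c∈)
    unique : Unique (X ++ Pₗ ++ Y)
    unique = Unique.++⁺ (sorted⇒Unique (proj₂ (proj₂ sortedX)))
      (Unique.++⁺ Pₗ-unique (sorted⇒Unique (proj₂ (proj₂ sortedY))) (λ (c∈P , c∈Y) → proj₂ (Y⁻ c∈Y) c∈P))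
      (λ (c∈X , c∈rest) → rest⁻ c∈rest (X⁻ c∈X))
    complete : ∀ v → v ∈ X ++ Pₗ ++ Y
    complete v with R v Bool.≟ true | v ∈? Pₗ
    ... | yes Rv | _ = ∈-++⁺ˡ (∈-resp-↭ (↭-sym (proj₁ (proj₂ sortedX)))
            (∈-filter⁺ (λ c → R c Bool.≟ true) (∈-allFin v) Rv))
    ... | no ¬Rv | yes v∈P = ∈-++⁺ʳ X (∈-++⁺ˡ v∈P)
    ... | no ¬Rv | no v∉P = ∈-++⁺ʳ X (∈-++⁺ʳ Pₗ (∈-resp-↭ (↭-sym (proj₁ (proj₂ sortedY)))
            (∈-filter⁺ inY? (∈-allFin v) (¬Rv , v∉P))))

    -- `J` keeps only those fill edges of `H` that lie within one side, off the path. So path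
    -- vertices have the same neighbours as in `A`, and `R` is left only by the edge from `u` to
    -- `a 0`.
    J : Adj n
    J c d = A c d ∨ (H c d ∧ ((R c ∧ R d) ∨ (⌊ inY? c ⌋ ∧ ⌊ inY? d ⌋)))
    Same : Fin n → Fin n → Set
    Same c d = (R c ≡ true × R d ≡ true) ⊎ ((R c ≢ true × c ∉ Pₗ) × (R d ≢ true × d ∉ Pₗ))
    J⁻ : ∀ {c d} → J c d ≡ true → A c d ≡ true ⊎ (H c d ≡ true × Same c d)
    J⁻ {c} {d} e with ∨-true⁻ {A c d} e
    ... | inj₁ h = inj₁ h
    ... | inj₂ f with ∧-true⁻ {H c d} f
    ...   | h , g with ∨-true⁻ {R c ∧ R d} g
    ...     | inj₁ b = inj₂ (h , inj₁ (∧-true⁻ b))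
    ...     | inj₂ b = let p , q = ∧-true⁻ {⌊ inY? c ⌋} b in
                inj₂ (h , inj₂ (⌊⌋-true⁻ {P? = inY? c} p , ⌊⌋-true⁻ {P? = inY? d} q))
    J⁺ : ∀ {c d} → H c d ≡ true → Same c d → J c d ≡ true
    J⁺ {c} {d} h (inj₁ (p , q)) = ∨-true⁺ {A c d} (inj₂ (∧-true⁺ h (∨-true⁺ {R c ∧ R d} (inj₁ (∧-true⁺ p q)))))
    J⁺ {c} {d} h (inj₂ (p , q)) = ∨-true⁺ {A c d} (inj₂ (∧-true⁺ h (∨-true⁺ {R c ∧ R d} (inj₂
      (∧-true⁺ {⌊ inY? c ⌋} {⌊ inY? d ⌋} (⌊⌋-true⁺ {P? = inY? c} p) (⌊⌋-true⁺ {P? = inY? d} q))))))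
    A⊑J : A ⊑ J
    A⊑J h = ∨-true⁺ (inj₁ h)
    J⊑H : J ⊑ H
    J⊑H e = [ contains , proj₁ ] (J⁻ e)
    J-path : ∀ {i d} → i < k → J (a i) d ≡ true → A (a i) d ≡ true
    J-path {i} i<k e with J⁻ e
    ... | inj₁ h                            = h
    ... | inj₂ (_ , inj₁ (Ra , _))          = ⊥-elim (a∉R i i<k Ra)
    ... | inj₂ (_ , inj₂ ((_ , a∉P) , _)) = ⊥-elim (a∉P (∈-applyUpTo⁺ a i<k))
    J-inner : InnerPath J u a k
    J-inner = record
      { distinct = distinct ; start≢ = start≢ ; end≢ = end≢
      ; edge₀ = A⊑J ∘ edge₀ ; edge = A⊑J ∘ edge
      ; nbr₀ = λ p e → nbr₀ p (J-path p e) ; nbr = λ p e → nbr p (J-path p e) }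
    Y-perfect : ∀ {M} → (∀ {c} → c ∈ M → R c ≢ true × c ∉ Pₗ) → Perfect H M → Perfect J M
    Y-perfect side []        = []
    Y-perfect side (py ∷ perf) =
      (λ c∈ d∈ c≢d yc yd → J⁺ (py c∈ d∈ c≢d (J⊑H yc) (J⊑H yd)) (inj₂ (side (there c∈) , side (there d∈))))
      ∷ Y-perfect (side ∘ there) perf
    rest-perfect : Perfect J (Pₗ ++ Y)
    rest-perfect = path-perfect k a J-inner (λ u∈ → proj₁ (Y⁻ u∈) Ru)
      (λ i<k a∈ → proj₂ (Y⁻ a∈) (∈-applyUpTo⁺ a i<k)) (Y-perfect Y⁻ (sorted⇒Perfect T (proj₂ (proj₂ sortedY))))
    leave : ∀ {x c} → R x ≡ true → R c ≢ true → J x c ≡ true → x ≡ u × c ≡ a 0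
    leave Rx ¬Rc e with J⁻ e
    ... | inj₁ h                           = cross Rx ¬Rc h
    ... | inj₂ (_ , inj₁ (_ , Rc))         = ⊥-elim (¬Rc Rc)
    ... | inj₂ (_ , inj₂ ((¬Rx , _) , _)) = ⊥-elim (¬Rx Rx)
    X-perfect : ∀ {M} → (∀ {c} → c ∈ M → R c ≡ true) → AllPairs (λ c d → T′.rank c < T′.rank d) M →
      Perfect J (M ++ Pₗ ++ Y)
    X-perfect {[]}    side []            = rest-perfect
    X-perfect {x ∷ M} side (x< ∷ sorted) =
      (λ c∈ d∈ → clique (∈-++⁻ M c∈) (∈-++⁻ M d∈)) ∷ X-perfect (side ∘ there) sorted
      where
      Rx = side (here refl)
      u-last : ∀ {d} → d ∈ M → x ≢ u
      u-last {d} d∈ refl with d ≟ u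
      ... | yes refl = <-irrefl refl (All.lookup x< d∈)
      ... | no d≢u   = <-asym (All.lookup x< d∈) (proj₂ (proj₂ (reroot T u)) d≢u)
      -- Only `u` has a neighbour outside `R`, namely `a 0`, and nothing of `R` follows `u`. So the
      -- later neighbours of `x` all lie in `R`, or `x` is `u` and `a 0` is the only one.
      clique : ∀ {c d} → c ∈ M ⊎ c ∈ Pₗ ++ Y → d ∈ M ⊎ d ∈ Pₗ ++ Y → c ≢ d →
        J x c ≡ true → J x d ≡ true → J c d ≡ true
      clique (inj₁ c∈) (inj₁ d∈) c≢d xc xd = J⁺ (subst (λ Q → Q _ _ ≡ true) H′≡H
        (T′.perfect (All.lookup x< c∈) (All.lookup x< d∈) c≢d (toH′ xc) (toH′ xd)))
        (inj₁ (side (there c∈) , side (there d∈)))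
        where
        toH′ : ∀ {c d} → J c d ≡ true → T′.H c d ≡ true
        toH′ e = subst (λ Q → Q _ _ ≡ true) (sym H′≡H) (J⊑H e)
      clique (inj₁ c∈) (inj₂ d∈) c≢d xc xd = ⊥-elim (u-last c∈ (proj₁ (leave Rx (rest⁻ d∈) xd)))
      clique (inj₂ c∈) (inj₁ d∈) c≢d xc xd = ⊥-elim (u-last d∈ (proj₁ (leave Rx (rest⁻ c∈) xc)))
      clique (inj₂ c∈) (inj₂ d∈) c≢d xc xd = ⊥-elim (c≢d
        (trans (proj₂ (leave Rx (rest⁻ c∈) xc)) (sym (proj₂ (leave Rx (rest⁻ d∈) xd)))))
    J-perfect : Perfect J (X ++ Pₗ ++ Y)
    J-perfect = X-perfect X⁻ (proj₂ (proj₂ sortedX))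

  path-order : PathOrder a k λ L → fillList A L ≤ fill
  path-order with path-first-or-separated k a A S P T (Unique.filter⁺ (λ c → ¬? (c ∈? Pₗ)) (Unique.allFin⁺ n)) covers
    where
    covers : Covers (Pₗ ++ filter (λ c → ¬? (c ∈? Pₗ)) (allFin n)) A
    covers {c} _ with c ∈? Pₗ
    ... | yes c∈P = ∈-++⁺ˡ c∈P
    ... | no c∉P  = ∈-++⁺ʳ Pₗ (∈-filter⁺ (λ c → ¬? (c ∈? Pₗ)) (∈-allFin c) c∉P)
  ... | inj₂ (0<k , _ , _ , sep) = separated-order 0<k sep
  ... | inj₁ (M , M↭ , le) = [] , M , unique , complete , le
    where
    M⁻ : ∀ {c} → c ∈ M → c ∉ Pₗ
    M⁻ c∈ = proj₂ (∈-filter⁻ (λ c → ¬? (c ∈? Pₗ)) {xs = allFin n} (∈-resp-↭ M↭ c∈))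
    unique : Unique (Pₗ ++ M)
    unique = Unique.++⁺ Pₗ-unique
      (Unique-↭ (↭-sym M↭) (Unique.filter⁺ (λ c → ¬? (c ∈? Pₗ)) (Unique.allFin⁺ n)))
      (λ (c∈P , c∈M) → M⁻ c∈M c∈P)
    complete : ∀ v → v ∈ Pₗ ++ M
    complete v with v ∈? Pₗ
    ... | yes v∈P = ∈-++⁺ˡ v∈P
    ... | no v∉P  = ∈-++⁺ʳ Pₗ (∈-resp-↭ (↭-sym M↭) (∈-filter⁺ (λ c → ¬? (c ∈? Pₗ)) (∈-allFin v) v∉P))

-- Node orderings as lists

lookup-injective : ∀ {A : Set} {L : List A} → Unique L → ∀ i j → lookup L i ≡ lookup L j → i ≡ j
lookup-injective (x∉L ∷ uniq) zero    zero    e = refl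
lookup-injective (x∉L ∷ uniq) zero    (suc j) e = ⊥-elim (All.lookup x∉L (∈-lookup j) e)
lookup-injective (x∉L ∷ uniq) (suc i) zero    e = ⊥-elim (All.lookup x∉L (∈-lookup i) (sym e))
lookup-injective (x∉L ∷ uniq) (suc i) (suc j) e = cong suc (lookup-injective uniq i j e)

ordering-length : ∀ {n} {L : List (Fin n)} → Unique L → (∀ v → v ∈ L) → length L ≡ n
ordering-length {L = L} uniq complete = ≤-antisym
  (injective⇒≤ {f = lookup L} (lookup-injective uniq _ _))
  (injective⇒≤ {f = index ∘ complete} λ {v} {w} e →
    trans (lookup-index (complete v)) (trans (cong (lookup L) e) (sym (lookup-index (complete w)))))

-- Used with `A` as `Fin n` and `m` as `n`. Keeping the two apart allows matching the length
-- equation with `refl`, which would be circular if the type of `L` mentioned `m`.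
ordering-bijection : ∀ {A : Set} {m} {L : List A} → length L ≡ m → Unique L → (∀ v → v ∈ L) →
  Σ (Fin m ↔ A) λ π → map (Inverse.to π) (allFin m) ≡ L ×
    (∀ i → toℕ (Inverse.from π (lookup L i)) ≡ toℕ i)
ordering-bijection {L = L} refl uniq complete =
  mk↔ₛ′ (lookup L) (index ∘ complete) (λ v → sym (lookup-index (complete v))) inv ,
  trans (map-tabulate id (lookup L)) (tabulate-lookup L) ,
  λ i → cong toℕ (inv i)
  where
  inv : ∀ i → index (complete (lookup L i)) ≡ i
  inv i = lookup-injective uniq _ i (sym (lookup-index (complete (lookup L i))))

position : ∀ {A : Set} (X : List A) a k {Y j} → j < k → let L = X ++ applyUpTo a k ++ Y in
  ∃ λ (i : Fin (length L)) → toℕ i ≡ length X + j × lookup L i ≡ a j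
position []      a (suc k) {j = zero}  _   = zero , refl , refl
position []      a (suc k) {j = suc j} j<k =
  let i , p , q = position [] (a ∘ suc) k (s<s⁻¹ j<k) in suc i , cong suc p , q
position (x ∷ X) a k                   j<k =
  let i , p , q = position X a k j<k in suc i , cong suc p , q

listsOfLength : ∀ {A : Set} → List A → ℕ → List (List A)
listsOfLength xs zero    = [] ∷ []
listsOfLength xs (suc m) = cartesianProductWith _∷_ xs (listsOfLength xs m)

∈-listsOfLength : ∀ {n} (L : List (Fin n)) → L ∈ listsOfLength (allFin n) (length L)
∈-listsOfLength []      = here refl
∈-listsOfLength (x ∷ L) = ∈-cartesianProductWith⁺ _∷_ (∈-allFin x) (∈-listsOfLength L)

module _ {n : ℕ} (f : List (Fin n) → ℕ) where
  open Data.List.Extrema ≤-totalOrder using (argmin; argmin-all; f[argmin]≤f[xs])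
  open DecMembership (_≟_ {n}) using (_∈?_)

  minimum-ordering : ∃ λ L → (∀ v → v ∈ L) × (∀ {M} → length M ≡ n → (∀ v → v ∈ M) → f L ≤ f M)
  -- The default `allFin n` is itself complete, so the minimum is attained at a complete list in any
  -- case.
  minimum-ordering = argmin f (allFin n) candidates ,
    argmin-all f {xs = candidates} {P = λ L → ∀ v → v ∈ L} ∈-allFin (all-filter complete? (listsOfLength (allFin n) n)) ,
    λ {M} length≡n ∈M → All.lookup (f[argmin]≤f[xs] {f = f} (allFin n) candidates)
      (∈-filter⁺ complete? (subst (λ m → M ∈ listsOfLength (allFin n) m) length≡n (∈-listsOfLength M)) ∈M)
    where
    complete? : ∀ L → Dec (∀ v → v ∈ L)
    complete? L = all? (_∈? L)
    candidates : List (List (Fin n))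
    candidates = filter complete? (listsOfLength (allFin n) n)

module _ {n} (σ : Permutation′ n) where
  listing : List (Fin n)
  listing = map (σ ⟨$⟩ʳ_) (allFin n)

  length-listing : length listing ≡ n
  length-listing = trans (length-map (σ ⟨$⟩ʳ_) (allFin n)) (length-tabulate id)

  ∈-listing : ∀ v → v ∈ listing
  ∈-listing v = subst (_∈ listing) (inverseʳ σ) (∈-map⁺ (σ ⟨$⟩ʳ_) (∈-allFin (σ ⟨$⟩ˡ v)))

-- From a cheapest ordering to one with the path consecutive

theorem9 : ∀ {n} (G : Graph n) (k : ℕ) (a : ℕ → Fin n) →
    1 ≤ k →
    (∀ i j → 1 ≤ i → i ≤ k → 1 ≤ j → j ≤ k → a i ≡ a j → i ≡ j) →
    (∀ i → 1 ≤ i → i ≤ k → deg G (a i) ≡ 2) →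
    (∀ i → 1 ≤ i → i ≤ k → ∀ v → (adj G (a i) v ≡ true) ⇔ (v ≡ a (i ∸ 1) ⊎ v ≡ a (suc i))) →
    (∀ v → ¬ (Σ ℕ λ i → 1 ≤ i × i ≤ k × v ≡ a i) →
    (Σ ℕ λ i → 1 ≤ i × i ≤ k × adj G (a i) v ≡ true) ⇔ (v ≡ a 0 ⊎ v ≡ a (suc k))) →
    (∀ i → 1 ≤ i → i ≤ k → ¬ (a 0 ≡ a i) × ¬ (a (suc k) ≡ a i)) →
    Σ (Permutation′ n) λ σ′ → Σ ℕ λ p →
    (∀ j → j < k → toℕ (σ′ ⟨$⟩ˡ a (suc j)) ≡ p + j) ×
    (∀ σ → fillIn G σ′ ≤ fillIn G σ)
theorem9 {n} G k a _ inj _ nbrs _ ends =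
  let L , L-complete , L-minimal = minimum-ordering (fillList (adj G))
      T , _ , T≤L = fillList-triangulation L (adj G) simple (λ {c} _ → L-complete c)
      X , Y , uniq , complete , ≤T = path-order simple path T
      π , listed , at = ordering-bijection (ordering-length uniq complete) uniq complete
  in π , length X ,
     (λ j j<k → let i , i≡ , at-i = position X (a ∘ suc) k j<k in
       trans (cong (toℕ ∘ (π ⟨$⟩ˡ_)) (sym at-i)) (trans (at i) i≡)) ,
     (λ σ → subst (λ M → fillList (adj G) M ≤ fillIn G σ) (sym listed)
       (≤-trans ≤T (≤-trans T≤L (L-minimal (length-listing σ) (∈-listing σ)))))
  where
  simple : Simple (adj G)
  simple = record
    { symm = λ {c} {d} e → trans (Defs.sym G d c) e
    ; irr  = λ {c} e → false≢true (trans (sym (irrefl G c)) e) }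
    where
    false≢true : false ≢ true
    false≢true ()
  adjacent : ∀ {i v} → i < k → v ≡ a i ⊎ v ≡ a (2 + i) → adj G (a (suc i)) v ≡ true
  adjacent i<k = Equivalence.from (nbrs _ z<s i<k _)
  neighbour : ∀ {i v} → i < k → adj G (a (suc i)) v ≡ true → v ≡ a i ⊎ v ≡ a (2 + i)
  neighbour i<k = Equivalence.to (nbrs _ z<s i<k _)
  -- The indices shift by one: `InnerPath` numbers the inner vertices from 0 and keeps the start
  -- `a 0` separate.
  path : InnerPath (adj G) (a 0) (a ∘ suc) k
  path = record
    { distinct = λ p q e → suc-injective (inj _ _ z<s p z<s q e)
    ; start≢   = λ p → proj₁ (ends _ z<s p)
    ; end≢     = λ p → proj₂ (ends _ z<s p)
    ; edge₀    = λ p → Simple.symm simple (adjacent p (inj₁ refl))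
    ; edge     = λ p → adjacent p (inj₂ refl)
    ; nbr₀     = λ p → neighbour p
    ; nbr      = λ p → neighbour p
    }
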